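{- Let $\eta=(\omega,t)$ and $\eta'=(\omega',t')$ be points of $\Omega^*$, where $\omega,\omega'\in\mathbb{N}^*$ and $t,t'\in[0,1]$. Then $\nu_{\eta}$ and $\nu_{\eta'}$ are singular if and only if $o(\omega)\cap o(\omega')=\emptyset$, i.e., $\omega'\notin o(\omega)$.
   Context: $\mathbb{N}=\{1,2,3,\dots\}$, $\beta\mathbb{N}$ is its Stone–Čech compactification and $\mathbb{N}^*=\beta\mathbb{N}\setminus\mathbb{N}$, whose points are the free ultrafilters on $\mathbb{N}$. Let $\tau:\beta\mathbb{N}\to\beta\mathbb{N}$ be the continuous extension of $n\mapsto n+1$; its restriction to $\mathbb{N}^*$ is a homeomorphism of $\mathbb{N}^*$ onto itself. For $\omega\in\mathbb{N}^*$ put $o(\omega)=\{\tau^n\omega: n\in\mathbb{Z}\}$. $\Omega^*$ is the quotient space of $\mathbb{N}^*\times[0,1]$ obtained by identifying $(\omega,1)$ with $(\tau\omega,0)$ for all $\omega\in\mathbb{N}^*$. For $\eta=(\omega,t)\in\Omega^*$, with $\theta=2^t$, $\nu_\eta$ is the finitely additive probability measure on $\mathcal{P}(\mathbb{N})$ given by $\nu_\eta(A)=\omega\text{ - }\lim_n \frac{|A\cap\{1,\dots,[\theta\cdot 2^n]\}|}{\theta\cdot 2^n}$, the limit being taken along the ultrafilter $\omega$, where $[x]$ is the largest integer not exceeding $x$. Finitely additive probability measures $\mu,\nu$ on $\mathcal{P}(\mathbb{N})$ are singular if for every $\varepsilon>0$ there is $D\in\mathcal{P}(\mathbb{N})$ with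 $\mu(D)<\varepsilon$ and $\nu(D^c)<\varepsilon$. -}

module Defs where

open import Axiom.ExcludedMiddle using (ExcludedMiddle)
open import Data.Empty using (⊥-elim)
open import Data.Integer.Base as ℤ using (ℤ; +_; -[1+_])
import Data.Integer.Properties as ℤ
open import Data.List.Base using (List; []; _∷_; length; map; upTo; filter)
open import Data.List.Properties using (filter-≐; filter-all; length-filter; length-map; length-upTo)
import Data.List.Relation.Unary.All as All
open import Data.Nat.Base as ℕ using (ℕ; zero; suc; z≤n; s≤s)
import Data.Nat.Properties as ℕ
import Data.Nat.Coprimality as Coprimality
open import Data.Nat.GeneralisedArithmetic using (fold)
open import Data.Product.Base using (∃; ∃₂; _×_; _,_; proj₁; proj₂; swap)
open import Data.Rational.Base as ℚ using (ℚ; mkℚ; 0ℚ; 1ℚ; ½; _/_; 1/_)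
import Data.Rational.Properties as ℚ
open import Data.Rational.Solver using (module +-*-Solver)
import Data.Rational.Unnormalised.Base as ℚᵘ
import Data.Rational.Unnormalised.Properties as ℚᵘ
open import Data.Sum.Base using (_⊎_; inj₁; inj₂; [_,_])
open import Data.Unit.Base using (tt)
open import Function.Base using (_∘_; id)
open import Level using (0ℓ) renaming (suc to lsuc)
open import Relation.Binary.Bundles using (Setoid)
open import Relation.Binary.Core using (Rel)
open import Relation.Binary.Definitions using (tri<; tri≈; tri>)
import Relation.Binary.Construct.Closure.Equivalence as Closure
import Relation.Binary.Construct.Closure.ReflexiveTransitive as Star
open import Relation.Binary.Construct.Closure.Symmetric using (fwd; bwd)
open import Relation.Binary.PropositionalEquality
  using (_≡_; refl; sym; trans; cong; cong₂; subst; subst₂)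
open import Relation.Nullary using (¬_; Dec; yes; no; contradiction)
open import Relation.Unary
  using (Pred; _∈_; _∉_; _⊆_; _≐_; ∁; _∩_; _∪_; U; ∅; Empty; ｛_｝; _⊢_)

open import Algebra.Definitions.RawSemiring ℚ.+-*-rawSemiring using (_^_)

-- Opaque because unfolding rational arithmetic during conversion
-- checking is very expensive.
opaque

  nat : ℕ → ℚ
  nat k = + k / 1

  nat≡ : ∀ k → nat k ≡ mkℚ (+ k) 0 (Coprimality.sym (Coprimality.1-coprimeTo k))
  nat≡ k = ℚ.normalize-coprime _

  nat-0 : nat 0 ≡ 0ℚ
  nat-0 = refl

  nat-1 : nat 1 ≡ 1ℚ
  nat-1 = refl

  nat-+ : ∀ k l → nat (k ℕ.+ l) ≡ nat k ℚ.+ nat l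
  nat-+ k l rewrite nat≡ k | nat≡ l =
    cong (_/ 1) (sym (cong₂ ℤ._+_ (ℤ.*-identityʳ (+ k)) (ℤ.*-identityʳ (+ l))))

  nat-* : ∀ k l → nat (k ℕ.* l) ≡ nat k ℚ.* nat l
  nat-* k l rewrite nat≡ k | nat≡ l = cong (_/ 1) (ℤ.pos-* k l)

nat-mono-≤ : ∀ k l → k ℕ.≤ l → nat k ℚ.≤ nat l
nat-mono-≤ k l k≤l = subst₂ ℚ._≤_ (sym (nat≡ k)) (sym (nat≡ l))
  (ℚ.*≤* (ℤ.*-monoʳ-≤-nonNeg (+ 1) (ℤ.+≤+ k≤l)))

nat-cancel-≤ : ∀ k l → nat k ℚ.≤ nat l → k ℕ.≤ l
nat-cancel-≤ k l h with ℚ.drop-*≤* (subst₂ ℚ._≤_ (nat≡ k) (nat≡ l) h)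
... | h′ rewrite ℤ.*-identityʳ (+ k) | ℤ.*-identityʳ (+ l) = ℤ.drop‿+≤+ h′

nat-mono-< : ∀ k l → k ℕ.< l → nat k ℚ.< nat l
nat-mono-< k l k<l = ℚ.≰⇒> λ h → ℕ.<⇒≱ k<l (nat-cancel-≤ l k h)

nat-0≤ : ∀ k → 0ℚ ℚ.≤ nat k
nat-0≤ k = subst (ℚ._≤ nat k) nat-0 (nat-mono-≤ 0 k z≤n)

nat-0< : ∀ k → 0 ℕ.< k → 0ℚ ℚ.< nat k
nat-0< k 0<k = subst (ℚ._< nat k) nat-0 (nat-mono-< 0 k 0<k)

0<1 : 0ℚ ℚ.< 1ℚ
0<1 = ℚ.positive⁻¹ 1ℚ

nat-^ : ∀ b k → nat (b ℕ.^ k) ≡ nat b ^ k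
nat-^ b zero    = nat-1
nat-^ b (suc k) = trans (nat-* b (b ℕ.^ k)) (cong (nat b ℚ.*_) (nat-^ b k))

<⇒≱ : ∀ {p q} → p ℚ.< q → ¬ (q ℚ.≤ p)
<⇒≱ p<q q≤p = ℚ.<-irrefl refl (ℚ.<-≤-trans p<q q≤p)

/-cancel-≤1 : ∀ m d → + m / suc d ℚ.≤ 1ℚ → m ℕ.≤ suc d
/-cancel-≤1 m d h
  with ℚᵘ.drop-*≤* (ℚᵘ.≤-respˡ-≃ (ℚ.toℚᵘ-fromℚᵘ (ℚᵘ.mkℚᵘ (+ m) d)) (ℚ.toℚᵘ-mono-≤ h))
... | h′ rewrite ℤ.*-identityʳ (+ m) | ℕ.+-identityʳ d = ℤ.drop‿+≤+ h′

^-mono-< : ∀ p q n → 0ℚ ℚ.< p → p ℚ.< q → p ^ suc n ℚ.< q ^ suc n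
^-mono-< p q zero    0<p p<q = subst₂ ℚ._<_ (sym (ℚ.*-identityʳ p)) (sym (ℚ.*-identityʳ q)) p<q
^-mono-< p q (suc n) 0<p p<q = ℚ.<-trans
  (ℚ.*-monoʳ-<-pos p {{ℚ.positive 0<p}} (^-mono-< p q n 0<p p<q))
  (ℚ.*-monoˡ-<-pos (q ^ suc n) {{ℚ.positive (0<^ (suc n))}} p<q)
  where
  0<q : 0ℚ ℚ.< q
  0<q = ℚ.<-trans 0<p p<q
  0<^ : ∀ k → 0ℚ ℚ.< q ^ k
  0<^ zero    = 0<1
  0<^ (suc k) = subst (ℚ._< q ^ suc k) (ℚ.*-zeroʳ q) (ℚ.*-monoʳ-<-pos q {{ℚ.positive 0<q}} (0<^ k))

archimedean : ∀ δ → 0ℚ ℚ.< δ → ∀ c → ∃ λ N → c ℚ.≤ nat N ℚ.* δ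
archimedean δ 0<δ c = N , ℚ.≤-trans (c≤nat c) (subst₂ ℚ._≤_ eq refl
    (ℚ.*-monoʳ-≤-nonNeg δ {{ℚ.nonNegative (ℚ.<⇒≤ 0<δ)}} step))
  where
  instance
    δ≢0 : ℚ.NonZero δ
    δ≢0 = ℚ.>-nonZero 0<δ
  bound : ℚ → ℕ
  bound p = ℤ.∣ ℚ.numerator p ∣
  c≤nat : ∀ p → p ℚ.≤ nat (bound p)
  c≤nat p@(mkℚ n d _) = subst (p ℚ.≤_) (sym (nat≡ (bound p))) (ℚ.*≤* (ℤ.≤-trans
    (ℤ.≤-reflexive (ℤ.*-identityʳ n))
    (ℤ.≤-trans (≤abs n) (subst (+ ℤ.∣ n ∣ ℤ.≤_) (ℤ.pos-* ℤ.∣ n ∣ (suc d)) (ℤ.+≤+ (ℕ.m≤m*n ℤ.∣ n ∣ (suc d)))))))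
    where
    ≤abs : ∀ i → i ℤ.≤ + ℤ.∣ i ∣
    ≤abs (+ k)    = ℤ.≤-refl
    ≤abs -[1+ k ] = ℤ.-≤+
  M = bound c
  N = M ℕ.* bound (1/ δ)
  step : nat M ℚ.* 1/ δ ℚ.≤ nat N
  step rewrite nat-* M (bound (1/ δ)) =
    ℚ.*-monoˡ-≤-nonNeg (nat M) {{ℚ.nonNegative (nat-0≤ M)}} (c≤nat (1/ δ))
  eq : nat M ℚ.* 1/ δ ℚ.* δ ≡ nat M
  eq = trans (ℚ.*-assoc (nat M) (1/ δ) δ)
    (trans (cong (nat M ℚ.*_) (ℚ.*-inverseˡ δ)) (ℚ.*-identityʳ (nat M)))

split : ∀ {q} u v → q ℚ.< u ℚ.+ v →
        ∃₂ λ a b → a ℚ.< u × b ℚ.< v × q ℚ.< a ℚ.+ b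
split {q} u v q<u+v with ℚ.<-dense q<u+v
... | m , q<m , m<u+v = u ℚ.- h , v ℚ.- h , below u , below v ,
  subst (q ℚ.<_) (sym eq) q<m
  where
  d = (u ℚ.+ v) ℚ.- m
  h = ½ ℚ.* d
  0<d : 0ℚ ℚ.< d
  0<d = subst (ℚ._< d) (ℚ.+-inverseʳ m) (ℚ.+-monoˡ-< (ℚ.- m) m<u+v)
  0<h : 0ℚ ℚ.< h
  0<h = subst (ℚ._< h) (ℚ.*-zeroʳ ½) (ℚ.*-monoʳ-<-pos ½ 0<d)
  below : ∀ w → w ℚ.- h ℚ.< w
  below w = subst (w ℚ.- h ℚ.<_) (ℚ.+-identityʳ w) (ℚ.+-monoʳ-< w (ℚ.neg-antimono-< 0<h))
  eq : (u ℚ.- h) ℚ.+ (v ℚ.- h) ≡ m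
  eq = solve 3 (λ u v m → (u :- con ½ :* (u :+ v :- m)) :+ (v :- con ½ :* (u :+ v :- m)) := m) refl u v m
    where open +-*-Solver

≤-subtract : ∀ p q s u r → u ℚ.* r ≡ p → s ℚ.* r ℚ.≤ p ℚ.+ q → (s ℚ.- u) ℚ.* r ℚ.≤ q
≤-subtract p q s u r refl sr≤p+q = subst₂ ℚ._≤_
  (solve 3 (λ s r u → s :* r :- u :* r := (s :- u) :* r) refl s r u)
  (solve 2 (λ p q → p :+ q :- p := q) refl (u ℚ.* r) q)
  (ℚ.+-monoˡ-≤ (ℚ.- (u ℚ.* r)) sr≤p+q)
  where open +-*-Solver

≤-add : ∀ p q s s′ r → s ℚ.* r ℚ.≤ p → s′ ℚ.* r ℚ.≤ q → (s ℚ.+ s′) ℚ.* r ℚ.≤ p ℚ.+ q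
≤-add p q s s′ r sr≤p s′r≤q =
  subst (ℚ._≤ p ℚ.+ q) (sym (ℚ.*-distribʳ-+ r s s′)) (ℚ.+-mono-≤ sr≤p s′r≤q)

+-cancel : ∀ u s → u ℚ.+ (s ℚ.- u) ≡ s
+-cancel = solve 2 (λ u s → u :+ (s :- u) := s) refl
  where open +-*-Solver

<-+ : ∀ w {δ} → 0ℚ ℚ.< δ → w ℚ.< w ℚ.+ δ
<-+ w {δ} 0<δ = subst (ℚ._< w ℚ.+ δ) (ℚ.+-identityʳ w) (ℚ.+-monoʳ-< w 0<δ)

+-step : ∀ a δ n → a ℚ.+ nat n ℚ.* δ ℚ.+ δ ≡ a ℚ.+ nat (suc n) ℚ.* δ
+-step a δ n = trans
  (solve 3 (λ a m d → a :+ m :* d :+ d := a :+ (con 1ℚ :+ m) :* d) refl a (nat n) δ)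
  (cong (λ m → a ℚ.+ m ℚ.* δ) (sym (trans (nat-+ 1 n) (cong (ℚ._+ nat n) nat-1))))
  where open +-*-Solver

quarter : ∀ q s → q ℚ.< s → ∃ λ δ → 0ℚ ℚ.< δ × δ ℚ.+ δ ℚ.+ (δ ℚ.+ δ) ≡ s ℚ.- q
quarter q s q<s = ½ ℚ.* (½ ℚ.* (s ℚ.- q)) , half-pos (half-pos 0<s-q) ,
  solve 1 (λ d → let δ = con ½ :* (con ½ :* d) in δ :+ δ :+ (δ :+ δ) := d) refl (s ℚ.- q)
  where
  open +-*-Solver
  0<s-q : 0ℚ ℚ.< s ℚ.- q
  0<s-q = subst (ℚ._< s ℚ.- q) (ℚ.+-inverseʳ q) (ℚ.+-monoˡ-< (ℚ.- q) q<s)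
  half-pos : ∀ {w} → 0ℚ ℚ.< w → 0ℚ ℚ.< ½ ℚ.* w
  half-pos {w} 0<w = subst (ℚ._< ½ ℚ.* w) (ℚ.*-zeroʳ ½) (ℚ.*-monoʳ-<-pos ½ 0<w)

+-4δ : ∀ a b q s δ → δ ℚ.+ δ ℚ.+ (δ ℚ.+ δ) ≡ s ℚ.- q → a ℚ.+ b ℚ.≤ q →
       (a ℚ.+ δ ℚ.+ δ) ℚ.+ (b ℚ.+ δ ℚ.+ δ) ℚ.≤ s
+-4δ a b q s δ 4δ≡s-q a+b≤q = subst₂ ℚ._≤_
  (solve 3 (λ a b δ → a :+ b :+ (δ :+ δ :+ (δ :+ δ)) := (a :+ δ :+ δ) :+ (b :+ δ :+ δ)) refl a b δ)
  (trans (cong (q ℚ.+_) 4δ≡s-q) (+-cancel q s))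
  (ℚ.+-monoˡ-≤ (δ ℚ.+ δ ℚ.+ (δ ℚ.+ δ)) a+b≤q)
  where open +-*-Solver

near-one : ∀ q → q ℚ.< 1ℚ →
           ∃₂ λ s d → q ℚ.< s × ∀ k → d ℕ.≤ k → s ℚ.* nat (suc k) ℚ.≤ nat k
near-one q q<1 = middle (ℚ.<-dense q<1)
  where
  Result = ∃₂ λ s d → q ℚ.< s × ∀ k → d ℕ.≤ k → s ℚ.* nat (suc k) ℚ.≤ nat k
  enough : ∀ s d K K⁺ → 0ℚ ℚ.< 1ℚ ℚ.- s → 1ℚ ℚ.≤ d ℚ.* (1ℚ ℚ.- s) → d ℚ.≤ K → K⁺ ≡ 1ℚ ℚ.+ K →
           s ℚ.* K⁺ ℚ.≤ K
  enough s d K _ 0<δ 1≤dδ d≤K refl = subst₂ ℚ._≤_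
    (solve 2 (λ s K → con 1ℚ :+ (s :* (con 1ℚ :+ K) :- con 1ℚ) := s :* (con 1ℚ :+ K)) refl s K)
    (solve 2 (λ s K → (con 1ℚ :+ K) :* (con 1ℚ :- s) :+ (s :* (con 1ℚ :+ K) :- con 1ℚ) := K) refl s K)
    (ℚ.+-monoˡ-≤ (s ℚ.* (1ℚ ℚ.+ K) ℚ.- 1ℚ) (ℚ.≤-trans 1≤dδ
      (ℚ.*-monoʳ-≤-nonNeg (1ℚ ℚ.- s) {{ℚ.nonNegative (ℚ.<⇒≤ 0<δ)}} (ℚ.≤-trans d≤K K≤1+K))))
    where
    open +-*-Solver
    K≤1+K : K ℚ.≤ 1ℚ ℚ.+ K
    K≤1+K = subst (ℚ._≤ 1ℚ ℚ.+ K) (ℚ.+-identityˡ K) (ℚ.+-monoˡ-≤ K (ℚ.<⇒≤ 0<1))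
  middle : (∃ λ s → q ℚ.< s × s ℚ.< 1ℚ) → Result
  middle (s , q<s , s<1) = result (archimedean (1ℚ ℚ.- s) 0<δ 1ℚ)
    where
    0<δ : 0ℚ ℚ.< 1ℚ ℚ.- s
    0<δ = subst (ℚ._< 1ℚ ℚ.- s) (ℚ.+-inverseʳ s) (ℚ.+-monoˡ-< (ℚ.- s) s<1)
    result : (∃ λ d → 1ℚ ℚ.≤ nat d ℚ.* (1ℚ ℚ.- s)) → Result
    result (d , 1≤dδ) = s , d , q<s , λ k d≤k →
      enough s (nat d) (nat k) (nat (suc k)) 0<δ 1≤dδ (nat-mono-≤ d k d≤k)
        (trans (nat-+ 1 k) (cong (ℚ._+ nat k) nat-1))

quotient : ∀ p r → 0ℚ ℚ.< r → ∃ λ u → u ℚ.* r ≡ p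
quotient p r 0<r = p ℚ.* 1/ r , trans (ℚ.*-assoc p (1/ r) r)
  (trans (cong (p ℚ.*_) (ℚ.*-inverseˡ r)) (ℚ.*-identityʳ p))
  where
  instance
    r≢0 : ℚ.NonZero r
    r≢0 = ℚ.>-nonZero 0<r

-- A real number is a Dedekind cut, given by its lower class.
record ℝ : Set₁ where
  field
    Below     : Pred ℚ 0ℓ
    inhabited : ∃ Below
    bounded   : ∃ λ b → b ∉ Below
    closed    : ∀ {p q} → p ℚ.< q → q ∈ Below → p ∈ Below
    rounded   : ∀ {p} → p ∈ Below → ∃ λ q → p ℚ.< q × q ∈ Below

open ℝ public

infix 4 _≤_ _<_ _≈_

_≤_ _<_ _≈_ : Rel ℝ 0ℓ
x ≤ y = Below x ⊆ Below y
x < y = ∃ λ q → q ∉ Below x × q ∈ Below y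
x ≈ y = Below x ≐ Below y

≈-refl : ∀ {x} → x ≈ x
≈-refl = id , id

≈-trans : ∀ {x y z} → x ≈ y → y ≈ z → x ≈ z
≈-trans (a , b) (c , d) = c ∘ a , b ∘ d

below<above : ∀ x {a b} → a ∈ Below x → b ∉ Below x → a ℚ.< b
below<above x {a} {b} a∈ b∉ with ℚ.<-cmp a b
... | tri< a<b _ _ = a<b
... | tri≈ _ refl _ = ⊥-elim (b∉ a∈)
... | tri> _ _ b<a = ⊥-elim (b∉ (closed x b<a a∈))

closed-≤ : ∀ x {p q} → p ℚ.≤ q → q ∈ Below x → p ∈ Below x
closed-≤ x {p} {q} p≤q q∈ with rounded x q∈
... | r , q<r , r∈ = closed x (ℚ.≤-<-trans p≤q q<r) r∈

-- The least upper bound of a nonempty set of rationals bounded above.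
⨆ : (S : Pred ℚ 0ℓ) → ∃ S → (∃ λ b → ∀ {s} → s ∈ S → s ℚ.≤ b) → ℝ
⨆ S (s , s∈) (b , S≤b) = record
  { Below     = λ q → ∃ λ s → s ∈ S × q ℚ.< s
  ; inhabited = s ℚ.- 1ℚ , s , s∈ , s-1<s
  ; bounded   = b , λ { (r , r∈ , b<r) → <⇒≱ b<r (S≤b r∈) }
  ; closed    = λ { p<q (r , r∈ , q<r) → r , r∈ , ℚ.<-trans p<q q<r }
  ; rounded   = λ { (r , r∈ , p<r) → let q , p<q , q<r = ℚ.<-dense p<r in q , p<q , r , r∈ , q<r }
  }
  where
  s-1<s : s ℚ.- 1ℚ ℚ.< s
  s-1<s = subst (s ℚ.- 1ℚ ℚ.<_) (ℚ.+-identityʳ s) (ℚ.+-monoʳ-< s (ℚ.negative⁻¹ (ℚ.- 1ℚ)))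

fromℚ : ℚ → ℝ
fromℚ q = ⨆ ｛ q ｝ (q , refl) (q , λ { refl → ℚ.≤-refl })

fromℕ : ℕ → ℝ
fromℕ k = fromℚ (nat k)

0ℝ 1ℝ : ℝ
0ℝ = fromℚ 0ℚ
1ℝ = fromℚ 1ℚ

fromℚ-mono-≤ : ∀ {p q} → p ℚ.≤ q → fromℚ p ≤ fromℚ q
fromℚ-mono-≤ p≤q (_ , refl , r<p) = _ , refl , ℚ.<-≤-trans r<p p≤q

fromℚ-cancel-≤ : ∀ {p q} → fromℚ p ≤ fromℚ q → p ℚ.≤ q
fromℚ-cancel-≤ {p} {q} h = ℚ.≮⇒≥ λ q<p → absurd (h (p , refl , q<p))
  where
  absurd : ¬ (q ∈ Below (fromℚ q))
  absurd (_ , refl , q<q) = ℚ.<-irrefl refl q<q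

≤-above : ∀ {p x r} → fromℚ p ≤ x → r ∉ Below x → p ℚ.≤ r
≤-above {p} {x} p≤x r∉ = ℚ.≮⇒≥ λ r<p → r∉ (p≤x (p , refl , r<p))

infixl 6 _+_

_+_ : ℝ → ℝ → ℝ
x + y = ⨆ (λ s → ∃₂ λ a b → a ∈ Below x × b ∈ Below y × s ≡ a ℚ.+ b)
  (let a , a∈ = inhabited x ; b , b∈ = inhabited y in a ℚ.+ b , a , b , a∈ , b∈ , refl)
  (let c , c∉ = bounded x ; d , d∉ = bounded y in c ℚ.+ d , λ
    { (a , b , a∈ , b∈ , refl) → ℚ.<⇒≤ (ℚ.+-mono-< (below<above x a∈ c∉) (below<above y b∈ d∉)) })

infixl 7 _·_ _÷_

_·_ : ℕ → ℝ → ℝ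
k · x = ⨆ (λ s → ∃ λ a → a ∈ Below x × s ≡ nat k ℚ.* a)
  (let a , a∈ = inhabited x in nat k ℚ.* a , a , a∈ , refl)
  (let c , c∉ = bounded x in nat k ℚ.* c , λ
    { (a , a∈ , refl) → ℚ.*-monoˡ-≤-nonNeg (nat k) {{ℚ.nonNegative (nat-0≤ k)}}
        (ℚ.<⇒≤ (below<above x a∈ c∉)) })

·-mono-≤ : ∀ k {x y} → x ≤ y → k · x ≤ k · y
·-mono-≤ k x≤y (s , (a , a∈ , eq) , q<s) = s , (a , x≤y a∈ , eq) , q<s

·-fromℚ : ∀ k .{{_ : ℕ.NonZero k}} c → k · fromℚ c ≈ fromℚ (nat k ℚ.* c)
·-fromℚ k c = to , from
  where
  0<k : 0ℚ ℚ.< nat k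
  0<k = nat-0< k (ℕ.>-nonZero⁻¹ k)
  instance
    k>0 : ℚ.Positive (nat k)
    k>0 = ℚ.positive 0<k
    k≢0 : ℚ.NonZero (nat k)
    k≢0 = ℚ.>-nonZero 0<k
  to : k · fromℚ c ≤ fromℚ (nat k ℚ.* c)
  to (_ , (a , (_ , refl , a<c) , refl) , q<ka) =
    _ , refl , ℚ.<-trans q<ka (ℚ.*-monoʳ-<-pos (nat k) a<c)
  from : fromℚ (nat k ℚ.* c) ≤ k · fromℚ c
  from {q} (_ , refl , q<kc) with ℚ.<-dense q<kc
  ... | m , q<m , m<kc = m , (1/ nat k ℚ.* m , (c , refl , a<c) , sym eq) , q<m
    where
    eq : nat k ℚ.* (1/ nat k ℚ.* m) ≡ m
    eq = trans (sym (ℚ.*-assoc (nat k) (1/ nat k) m))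
      (trans (cong (ℚ._* m) (ℚ.*-inverseʳ (nat k))) (ℚ.*-identityˡ m))
    a<c : 1/ nat k ℚ.* m ℚ.< c
    a<c = ℚ.*-cancelˡ-<-nonNeg (nat k) {{ℚ.pos⇒nonNeg (nat k)}} (subst (ℚ._< nat k ℚ.* c) (sym eq) m<kc)

above-pos : ∀ {x r} → 0ℝ < x → r ∉ Below x → 0ℚ ℚ.< r
above-pos {x} {r} (q , q∉0 , q∈x) r∉ = ℚ.≤-<-trans
  (ℚ.≮⇒≥ λ q<0 → q∉0 (0ℚ , refl , q<0)) (below<above x q∈x r∉)

-- For k ≥ 0 and x > 0, k ÷ x is the supremum of the rationals q such
-- that q * r ≤ k for some rational r ≥ x.
_÷_ : ℕ → ∃ (0ℝ <_) → ℝ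
k ÷ (x , 0<x) = ⨆ (λ q → ∃ λ r → r ∉ Below x × q ℚ.* r ℚ.≤ nat k)
  (let r , r∉ = bounded x in
   0ℚ , r , r∉ , subst (ℚ._≤ nat k) (sym (ℚ.*-zeroˡ r)) 0≤k)
  (bound , ≤bound)
  where
  0≤k : 0ℚ ℚ.≤ nat k
  0≤k = nat-0≤ k
  0<c : ∃ λ c → c ∈ Below x × 0ℚ ℚ.< c
  0<c = let q , q∉0 , q∈x = 0<x ; c , q<c , c∈x = rounded x q∈x in
    c , c∈x , ℚ.≤-<-trans (ℚ.≮⇒≥ λ q<0 → q∉0 (0ℚ , refl , q<0)) q<c
  c = proj₁ 0<c
  instance
    c>0 : ℚ.Positive c
    c>0 = ℚ.positive (proj₂ (proj₂ 0<c))
  bound = proj₁ (quotient (nat k) c (proj₂ (proj₂ 0<c)))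
  bound*c = proj₂ (quotient (nat k) c (proj₂ (proj₂ 0<c)))
  0≤bound : 0ℚ ℚ.≤ bound
  0≤bound = ℚ.*-cancelʳ-≤-pos c (subst₂ ℚ._≤_ (sym (ℚ.*-zeroˡ c)) (sym bound*c) 0≤k)
  ≤bound : ∀ {q} → (∃ λ r → r ∉ Below x × q ℚ.* r ℚ.≤ nat k) → q ℚ.≤ bound
  ≤bound {q} (r , r∉ , qr≤k) = ℚ.≮⇒≥ λ b<q →
    let 0<q = ℚ.≤-<-trans 0≤bound b<q in
    <⇒≱ (ℚ.<-trans (subst (ℚ._< q ℚ.* c) bound*c (ℚ.*-monoˡ-<-pos c b<q))
                     (ℚ.*-monoʳ-<-pos q {{ℚ.positive 0<q}} (below<above x (proj₁ (proj₂ 0<c)) r∉)))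
           qr≤k

÷-cong : ∀ k {x y} → proj₁ x ≈ proj₁ y → k ÷ x ≈ k ÷ y
÷-cong k (x≤y , y≤x) =
  (λ { (s , (r , r∉ , h) , q<s) → s , (r , r∉ ∘ y≤x , h) , q<s }) ,
  (λ { (s , (r , r∉ , h) , q<s) → s , (r , r∉ ∘ x≤y , h) , q<s })

÷-nonneg : ∀ k x → 0ℝ ≤ k ÷ x
÷-nonneg k (x , _) (_ , refl , q<0) = let r , r∉ = bounded x in
  0ℚ , (r , r∉ , subst (ℚ._≤ nat k) (sym (ℚ.*-zeroˡ r)) (nat-0≤ k)) , q<0

÷-≤1 : ∀ k x → fromℕ k ≤ proj₁ x → 1ℚ ∉ Below (k ÷ x)
÷-≤1 k (x , 0<x) k≤x (s , (r , r∉ , sr≤k) , 1<s) =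
  <⇒≱ (subst (ℚ._< s ℚ.* r) (ℚ.*-identityˡ r)
        (ℚ.*-monoˡ-<-pos r {{ℚ.positive (above-pos {x} 0<x r∉)}} 1<s))
      (ℚ.≤-trans sr≤k (≤-above {x = x} k≤x r∉))

÷-shrink : ∀ k {s r r′} → r′ ℚ.≤ r → 0ℚ ℚ.< r′ → s ℚ.* r ℚ.≤ nat k → s ℚ.* r′ ℚ.≤ nat k
÷-shrink k {s} {r} {r′} r′≤r 0<r′ sr≤k with ℚ.≤-total 0ℚ s
... | inj₁ 0≤s = ℚ.≤-trans (ℚ.*-monoˡ-≤-nonNeg s {{ℚ.nonNegative 0≤s}} r′≤r) sr≤k
... | inj₂ s≤0 = ℚ.≤-trans
  (subst (s ℚ.* r′ ℚ.≤_) (ℚ.*-zeroˡ r′) (ℚ.*-monoʳ-≤-nonNeg r′ {{ℚ.nonNegative (ℚ.<⇒≤ 0<r′)}} s≤0))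
  (nat-0≤ k)

÷-distrib-+ : ∀ k l x → (k ℕ.+ l) ÷ x ≈ k ÷ x + l ÷ x
÷-distrib-+ k l X@(x , 0<x) = to , from
  where
  to : (k ℕ.+ l) ÷ X ≤ k ÷ X + l ÷ X
  to {q} (s , (r , r∉ , sr≤k+l) , q<s) = finish
    (quotient (nat k) r (above-pos {x} 0<x r∉))
    where
    finish : (∃ λ u → u ℚ.* r ≡ nat k) → q ∈ Below (k ÷ X + l ÷ X)
    finish (u , ur≡k) = pieces (split u (s ℚ.- u) (subst (q ℚ.<_) (sym (+-cancel u s)) q<s))
      where
      vr≤l : (s ℚ.- u) ℚ.* r ℚ.≤ nat l
      vr≤l = ≤-subtract (nat k) (nat l) s u r ur≡k (subst (s ℚ.* r ℚ.≤_) (nat-+ k l) sr≤k+l)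
      pieces : (∃₂ λ a b → a ℚ.< u × b ℚ.< s ℚ.- u × q ℚ.< a ℚ.+ b) → q ∈ Below (k ÷ X + l ÷ X)
      pieces (a , b , a<u , b<v , q<a+b) = a ℚ.+ b ,
        (a , b , (u , (r , r∉ , ℚ.≤-reflexive ur≡k) , a<u) , (s ℚ.- u , (r , r∉ , vr≤l) , b<v) , refl) ,
        q<a+b
  from : k ÷ X + l ÷ X ≤ (k ℕ.+ l) ÷ X
  from (_ , (a , b , (s , (r , r∉ , sr≤k) , a<s) , (s′ , (r′ , r′∉ , s′r′≤l) , b<s′) , refl) , q<a+b) =
    s ℚ.+ s′ , common (ℚ.≤-total r r′) , ℚ.<-trans q<a+b (ℚ.+-mono-< a<s b<s′)
    where
    Goal = ∃ λ ρ → ρ ∉ Below x × (s ℚ.+ s′) ℚ.* ρ ℚ.≤ nat (k ℕ.+ l)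
    combine : ∀ ρ → ρ ∉ Below x → ρ ℚ.≤ r → ρ ℚ.≤ r′ → Goal
    combine ρ ρ∉ ρ≤r ρ≤r′ = ρ , ρ∉ , subst ((s ℚ.+ s′) ℚ.* ρ ℚ.≤_) (sym (nat-+ k l))
      (≤-add (nat k) (nat l) s s′ ρ
        (÷-shrink k {s} {r} {ρ} ρ≤r 0<ρ sr≤k) (÷-shrink l {s′} {r′} {ρ} ρ≤r′ 0<ρ s′r′≤l))
      where 0<ρ = above-pos {x} 0<x ρ∉
    common : r ℚ.≤ r′ ⊎ r′ ℚ.≤ r → Goal
    common (inj₁ r≤r′) = combine r r∉ ℚ.≤-refl r≤r′
    common (inj₂ r′≤r) = combine r′ r′∉ r′≤r ℚ.≤-refl

-- Only used for positive reals, whose integer part is a natural number.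
IsFloor : ℝ → ℕ → Set
IsFloor x k = fromℕ k ≤ x × (∀ m → fromℕ m ≤ x → m ℕ.≤ k)

<⇒≤ : ∀ {x y} → x < y → x ≤ y
<⇒≤ {x} {y} (q , q∉ , q∈) p∈ = closed y (below<above x p∈ q∉) q∈

record [0,1] : Set₁ where
  field
    value : ℝ
    0≤    : 0ℝ ≤ value
    ≤1    : value ≤ 1ℝ

open [0,1] public

2^-upper : ∀ t {s} m n-1 → fromℚ (+ m / suc n-1) ≤ value t →
           s ^ suc n-1 ℚ.≤ nat (2 ℕ.^ m) → s ℚ.≤ nat 2
2^-upper t {s} m n-1 m/n≤t s^n≤2^m = ℚ.≮⇒≥ λ 2<s →
  <⇒≱ (^-mono-< (nat 2) s n-1 (nat-0< 2 (s≤s z≤n)) 2<s)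
    (ℚ.≤-trans s^n≤2^m (subst (nat (2 ℕ.^ m) ℚ.≤_) (nat-^ 2 (suc n-1))
      (nat-mono-≤ (2 ℕ.^ m) (2 ℕ.^ suc n-1)
        (ℕ.^-monoʳ-≤ 2 (/-cancel-≤1 m n-1 (fromℚ-cancel-≤ (≤1 t ∘ m/n≤t)))))))

1^1≤2^0 : 1ℚ ^ 1 ℚ.≤ nat (2 ℕ.^ 0)
1^1≤2^0 = ℚ.≤-reflexive (trans (ℚ.*-identityʳ 1ℚ) (sym nat-1))

-- 2 ^ t is the supremum of 2 ^ (m / n) over the rationals 0 ≤ m / n ≤ t,
-- and s ≤ 2 ^ (m / n) holds for s ≥ 0 precisely when s ^ n ≤ 2 ^ m.
2^_ : [0,1] → ℝ
2^ t = ⨆ (λ s → ∃₂ λ m n-1 → fromℚ (+ m / suc n-1) ≤ value t × s ^ suc n-1 ℚ.≤ nat (2 ℕ.^ m))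
  (1ℚ , 0 , 0 , 0≤ t , 1^1≤2^0)
  (nat 2 , λ { (m , n-1 , m/n≤t , s^n≤2^m) → 2^-upper t m n-1 m/n≤t s^n≤2^m })

2^-cong : ∀ t t′ → value t ≈ value t′ → 2^ t ≈ 2^ t′
2^-cong t t′ (t≤t′ , t′≤t) =
  (λ { (s , (m , n , m/n≤t , h) , q<s) → s , (m , n , t≤t′ ∘ m/n≤t , h) , q<s }) ,
  (λ { (s , (m , n , m/n≤t , h) , q<s) → s , (m , n , t′≤t ∘ m/n≤t , h) , q<s })

1≤2^ : ∀ t → 1ℝ ≤ 2^ t
1≤2^ t (_ , refl , q<1) = 1ℚ , (0 , 0 , 0≤ t , 1^1≤2^0) , q<1

2^≤2 : ∀ t → 2^ t ≤ fromℕ 2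
2^≤2 t (s , (m , n-1 , m/n≤t , s^n≤2^m) , q<s) =
  nat 2 , refl , ℚ.<-≤-trans q<s (2^-upper t m n-1 m/n≤t s^n≤2^m)

2^0≈1 : ∀ t → value t ≈ 0ℝ → 2^ t ≈ 1ℝ
2^0≈1 t (t≤0 , _) = to , 1≤2^ t
  where
  to : 2^ t ≤ 1ℝ
  to (s , (zero , n-1 , _ , s^n≤1) , q<s) = 1ℚ , refl , ℚ.<-≤-trans q<s (ℚ.≮⇒≥ λ 1<s →
    <⇒≱ (^-mono-< 1ℚ s n-1 (0<1) 1<s) (subst (s ^ suc n-1 ℚ.≤_) (trans nat-1 (sym (1^ (suc n-1)))) s^n≤1))
    where
    1^ : ∀ k → 1ℚ ^ k ≡ 1ℚ
    1^ zero    = refl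
    1^ (suc k) = trans (ℚ.*-identityˡ (1ℚ ^ k)) (1^ k)
  to (s , (suc m , n-1 , m/n≤t , _) , q<s) = ⊥-elim
    (<⇒≱ (ℚ.positive⁻¹ _ {{ℚ.normalize-pos (suc m) (suc n-1)}}) (fromℚ-cancel-≤ (t≤0 ∘ m/n≤t)))

2^1≈2 : ∀ t → value t ≈ 1ℝ → 2^ t ≈ fromℕ 2
2^1≈2 t (_ , 1≤t) = 2^≤2 t , from
  where
  from : fromℕ 2 ≤ 2^ t
  from (_ , refl , q<2) = nat 2 , (1 , 0 , 1≤t , ℚ.≤-reflexive (ℚ.*-identityʳ (nat 2))) , q<2

2^n≤2^n·2^ : ∀ n t → fromℕ (2 ℕ.^ n) ≤ 2 ℕ.^ n · 2^ t
2^n≤2^n·2^ n t p∈ = ·-mono-≤ (2 ℕ.^ n) {1ℝ} {2^ t} (1≤2^ t)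
  (proj₂ (·-fromℚ (2 ℕ.^ n) {{ℕ.m^n≢0 2 n}} 1ℚ)
    (subst (λ c → _ ∈ Below (fromℚ c)) (sym (ℚ.*-identityʳ (nat (2 ℕ.^ n)))) p∈))

-- The real number θ * 2 ^ n with θ = 2 ^ t, and a proof that it is positive.
θ·2^ : [0,1] → ℕ → ∃ (0ℝ <_)
θ·2^ t n = 2 ℕ.^ n · 2^ t , 0ℚ , (λ { (_ , refl , 0<0) → ℚ.<-irrefl refl 0<0 }) ,
  2^n≤2^n·2^ n t (nat (2 ℕ.^ n) , refl , nat-0< (2 ℕ.^ n) (ℕ.m^n>0 2 n))

·-cong : ∀ k {x y} → x ≈ y → k · x ≈ k · y
·-cong k {x} {y} (x≤y , y≤x) = ·-mono-≤ k {x} {y} x≤y , ·-mono-≤ k {y} {x} y≤x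

θ·2^-cong : ∀ {t t′} n → value t ≈ value t′ → proj₁ (θ·2^ t n) ≈ proj₁ (θ·2^ t′ n)
θ·2^-cong {t} {t′} n t≈t′ = ·-cong (2 ℕ.^ n) {2^ t} {2^ t′} (2^-cong t t′ t≈t′)

θ·2^-glue : ∀ {t t′} n → value t ≈ 1ℝ → value t′ ≈ 0ℝ →
            proj₁ (θ·2^ t n) ≈ proj₁ (θ·2^ t′ (suc n))
θ·2^-glue {t} {t′} n t≈1 t′≈0 =
  ≈-trans {x} {k · fromℕ 2} {y} (·-cong k {2^ t} {fromℕ 2} (2^1≈2 t t≈1))
  (≈-trans {k · fromℕ 2} {fromℚ (nat k ℚ.* nat 2)} {y} (·-fromℚ k {{k≢0}} (nat 2))
  (swap (≈-trans {y} {l · 1ℝ} {fromℚ (nat k ℚ.* nat 2)} (·-cong l {2^ t′} {1ℝ} (2^0≈1 t′ t′≈0))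
    (subst (λ c → l · 1ℝ ≈ fromℚ c) eq (·-fromℚ l {{l≢0}} 1ℚ)))))
  where
  k = 2 ℕ.^ n
  l = 2 ℕ.^ suc n
  k≢0 = ℕ.m^n≢0 2 n
  l≢0 = ℕ.m^n≢0 2 (suc n)
  x = k · 2^ t
  y = l · 2^ t′
  eq : nat l ℚ.* 1ℚ ≡ nat k ℚ.* nat 2
  eq = trans (ℚ.*-identityʳ (nat l)) (trans (nat-* 2 k) (ℚ.*-comm (nat 2) (nat k)))

-- 1+ n stands for the positive integer suc n.
record ℕ⁺ : Set where
  constructor 1+_
  field index : ℕ

open ℕ⁺ public

val : ℕ⁺ → ℕ
val (1+ n) = suc n

suc⁺ : ℕ⁺ → ℕ⁺
suc⁺ (1+ n) = 1+ suc n

-- Inverse to suc⁺, except that pred⁺ 1 = 1.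
pred⁺ : ℕ⁺ → ℕ⁺
pred⁺ (1+ n) = 1+ ℕ.pred n

record βℕ : Set₁ where
  field
    Mem    : Pred (Pred ℕ⁺ 0ℓ) 0ℓ
    upward : ∀ {A B} → A ⊆ B → A ∈ Mem → B ∈ Mem
    meet   : ∀ {A B} → A ∈ Mem → B ∈ Mem → A ∩ B ∈ Mem
    proper : ∅ ∉ Mem
    ultra  : ∀ A → A ∈ Mem ⊎ ∁ A ∈ Mem

open βℕ public

infix 4 _≈ᵤ_ _≈*_

_≈ᵤ_ : Rel βℕ (lsuc 0ℓ)
ω ≈ᵤ ω′ = Mem ω ≐ Mem ω′

full : ∀ ω {A} → (∀ n → n ∈ A) → A ∈ Mem ω
full ω all∈ = [ upward ω (λ {n} _ → all∈ n) , upward ω (λ {n} _ → all∈ n) ] (ultra ω ∅)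

mem-∁ : ∀ ω {A} → A ∉ Mem ω → ∁ A ∈ Mem ω
mem-∁ ω {A} A∉ = [ (λ A∈ → contradiction A∈ A∉) , id ] (ultra ω A)

push : (ℕ⁺ → ℕ⁺) → βℕ → βℕ
push f ω = record
  { Mem    = λ A → (f ⊢ A) ∈ Mem ω
  ; upward = λ A⊆B → upward ω A⊆B
  ; meet   = meet ω
  ; proper = proper ω
  ; ultra  = λ A → ultra ω (f ⊢ A)
  }

-- The preimage under τ of a basic clopen set {ω : A ∈ Mem ω} is the
-- basic clopen set of suc⁺ ⊢ A, so τ is continuous; that it extends
-- suc⁺ is τ-principal below.
τ : βℕ → βℕ
τ = push suc⁺

record ℕ* : Set₁ where
  field
    ultrafilter : βℕ
    free        : ∀ n → ｛ n ｝ ∉ Mem ultrafilter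

open ℕ* public

_≈*_ : Rel ℕ* (lsuc 0ℓ)
ω ≈* ω′ = ultrafilter ω ≈ᵤ ultrafilter ω′

τ* : ℕ* → ℕ*
τ* ω = record { ultrafilter = τ (ultrafilter ω) ; free = τ-free }
  where
  τ-free : ∀ n → (suc⁺ ⊢ ｛ n ｝) ∉ Mem (ultrafilter ω)
  τ-free (1+ zero)    = proper (ultrafilter ω) ∘ upward (ultrafilter ω) λ ()
  τ-free (1+ suc m) h = free ω (1+ m) (upward (ultrafilter ω) (λ { refl → refl }) h)

τ*⁻¹ : ℕ* → ℕ*
τ*⁻¹ ω = record { ultrafilter = push pred⁺ (ultrafilter ω) ; free = pred-free }
  where
  pred-free : ∀ n → (pred⁺ ⊢ ｛ n ｝) ∉ Mem (ultrafilter ω)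
  pred-free n h = free ω (suc⁺ n) (upward (ultrafilter ω) only-suc
    (meet (ultrafilter ω) h (mem-∁ (ultrafilter ω) (free ω (1+ 0)))))
    where
    only-suc : (pred⁺ ⊢ ｛ n ｝) ∩ ∁ ｛ 1+ 0 ｝ ⊆ ｛ suc⁺ n ｝
    only-suc {1+ zero}  (_ , ≢1)   = contradiction refl ≢1
    only-suc {1+ suc m} (refl , _) = refl

τ*⁻¹-inverseˡ : ∀ ω → τ*⁻¹ (τ* ω) ≈* ω
τ*⁻¹-inverseˡ ω = id , id

τ*⁻¹-inverseʳ : ∀ ω → τ* (τ*⁻¹ ω) ≈* ω
τ*⁻¹-inverseʳ ω =
  (λ h → upward u (λ { {1+ zero} (_ , ≢1) → contradiction refl ≢1
                     ; {1+ suc m} (m∈ , _) → m∈ }) (meet u h u≢1)) ,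
  (λ h → upward u (λ { {1+ zero} (_ , ≢1) → contradiction refl ≢1
                     ; {1+ suc m} (m∈ , _) → m∈ }) (meet u h u≢1))
  where
  u = ultrafilter ω
  u≢1 = mem-∁ u (free ω (1+ 0))

τ^ : ℤ → ℕ* → ℕ*
τ^ (+ n)    ω = fold ω τ* n
τ^ -[1+ n ] ω = fold ω τ*⁻¹ (suc n)

o : ℕ* → Pred ℕ* (lsuc 0ℓ)
o ω ω′ = ∃ λ k → ω′ ≈* τ^ k ω

-- `same` identifies representations of the same point of ℕ* × [0,1], and
-- `glue` identifies (ω , 1) with (τ ω , 0).
data Glue : Rel (ℕ* × [0,1]) (lsuc 0ℓ) where
  same : ∀ {ω ω′ t t′} → ω ≈* ω′ → value t ≈ value t′ → Glue (ω , t) (ω′ , t′)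
  glue : ∀ {ω ω′ t t′} → ω′ ≈* τ* ω → value t ≈ 1ℝ → value t′ ≈ 0ℝ → Glue (ω , t) (ω′ , t′)

Ω* : Setoid (lsuc 0ℓ) (lsuc 0ℓ)
Ω* = Closure.setoid Glue

eventually : ∀ ω d → (λ n → d ℕ.≤ val n) ∈ Mem (ultrafilter ω)
eventually ω zero          = full (ultrafilter ω) λ _ → z≤n
eventually ω (suc zero)    = full (ultrafilter ω) λ _ → s≤s z≤n
eventually ω (suc (suc d)) = upward (ultrafilter ω)
  (λ { {1+ m} (d<1+m , d≢m) → ℕ.≤∧≢⇒< d<1+m λ { refl → d≢m refl } })
  (meet (ultrafilter ω) (eventually ω (suc d)) (mem-∁ (ultrafilter ω) (free ω (1+ d))))

BoundedSeq : Pred (ℕ⁺ → ℝ) 0ℓ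
BoundedSeq x = ∃₂ λ a b → ∀ n → a ∈ Below (x n) × b ∉ Below (x n)

-- The condition on x n and L says that the distance between them is less than ε.
IsLimit : βℕ → (ℕ⁺ → ℝ) → ℝ → Set₁
IsLimit ω x L = ∀ ε → 0ℝ < ε → (λ n → x n < L + ε × L < x n + ε) ∈ Mem ω

-- By lim-isLimit below this is the limit of x along ω.
lim : βℕ → (x : ℕ⁺ → ℝ) → BoundedSeq x → ℝ
lim ω x (a , b , a<x<b) = ⨆ (λ q → (λ n → q ∈ Below (x n)) ∈ Mem ω)
  (a , full ω (proj₁ ∘ a<x<b))
  (b , λ q∈ → ℚ.≮⇒≥ λ b<q → proper ω (upward ω (λ {n} q∈xₙ → proj₂ (a<x<b n) (closed (x n) b<q q∈xₙ)) q∈))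

lim-below : ∀ ω x bd {a} → a ∈ Below (lim ω x bd) → (λ n → a ∈ Below (x n)) ∈ Mem ω
lim-below ω x bd (s , s∈ , a<s) = upward ω (λ {n} → closed (x n) a<s) s∈

lim-above : ∀ ω x bd {a b} → a ∉ Below (lim ω x bd) → a ℚ.< b → (λ n → b ∉ Below (x n)) ∈ Mem ω
lim-above ω x bd a∉ a<b = mem-∁ ω λ b∈ → a∉ (_ , b∈ , a<b)

lim-mono-≤ : ∀ ω x bd y bd′ → (∀ n → x n ≤ y n) → lim ω x bd ≤ lim ω y bd′
lim-mono-≤ ω x bd y bd′ x≤y (s , s∈ , q<s) = s , upward ω (λ {n} → x≤y n) s∈ , q<s

lim-push : ∀ f ω ω′ x bd y bd′ → ω′ ≈ᵤ push f ω → (∀ n → x n ≈ y (f n)) →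
           lim ω x bd ≈ lim ω′ y bd′
lim-push f ω ω′ x bd y bd′ (ω′⊆ , ⊆ω′) x≈y =
  (λ { (s , s∈ , q<s) → s , ⊆ω′ (upward ω (λ {n} → proj₁ (x≈y n)) s∈) , q<s }) ,
  (λ { (s , s∈ , q<s) → s , upward ω (λ {n} → proj₂ (x≈y n)) (ω′⊆ s∈) , q<s })

lim-cong : ∀ ω x bd y bd′ → (∀ n → x n ≈ y n) → lim ω x bd ≈ lim ω y bd′
lim-cong ω x bd y bd′ x≈y =
  lim-mono-≤ ω x bd y bd′ (proj₁ ∘ x≈y) , lim-mono-≤ ω y bd′ x bd (proj₂ ∘ x≈y)

record FinAddProb : Set₁ where
  field
    measure  : Pred ℕ⁺ 0ℓ → ℝ
    cong-≐   : ∀ {A B} → A ≐ B → measure A ≈ measure B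
    nonneg   : ∀ A → 0ℝ ≤ measure A
    total    : measure U ≈ 1ℝ
    additive : ∀ {A B} → Empty (A ∩ B) → measure (A ∪ B) ≈ measure A + measure B

open FinAddProb public

Singular : Rel FinAddProb (lsuc 0ℓ)
Singular μ ν = ∀ ε → 0ℝ < ε → ∃ λ D → measure μ D < ε × measure ν (∁ D) < ε

infix 4 _≈ₘ_

_≈ₘ_ : Rel FinAddProb (lsuc 0ℓ)
μ ≈ₘ ν = ∀ A → measure μ A ≈ measure ν A

-- The mathematics is classical: limits along ultrafilters, integer parts
-- of reals and cardinalities of finite sets all need excluded middle.
module Classical (em : ExcludedMiddle 0ℓ) where

  principal : ℕ⁺ → βℕ
  principal n = record
    { Mem    = n ∈_
    ; upward = λ A⊆B → A⊆B
    ; meet   = _,_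
    ; proper = id
    ; ultra  = λ A → split-em (em {n ∈ A})
    }
    where
    split-em : ∀ {P : Set} → Dec P → P ⊎ ¬ P
    split-em (yes p) = inj₁ p
    split-em (no ¬p) = inj₂ ¬p

  τ-principal : ∀ n → τ (principal n) ≈ᵤ principal (suc⁺ n)
  τ-principal n = id , id

  near : ∀ x {δ} → 0ℚ ℚ.< δ → ∃ λ a → a ∈ Below x × a ℚ.+ δ ∉ Below x
  near x {δ} 0<δ = start (inhabited x) (bounded x)
    where
    Near = ∃ λ a → a ∈ Below x × a ℚ.+ δ ∉ Below x
    search : ∀ a → a ∈ Below x → ∀ n → a ℚ.+ nat n ℚ.* δ ∉ Below x → Near
    search a a∈ zero h = contradiction (subst (_∈ Below x) (sym a+0≡a) a∈) h
      where
      a+0≡a : a ℚ.+ nat 0 ℚ.* δ ≡ a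
      a+0≡a = trans (cong (λ z → a ℚ.+ z ℚ.* δ) nat-0)
        (trans (cong (a ℚ.+_) (ℚ.*-zeroˡ δ)) (ℚ.+-identityʳ a))
    search a a∈ (suc n) h = decide em
      where
      decide : Dec (a ℚ.+ nat n ℚ.* δ ∈ Below x) → Near
      decide (yes c) = a ℚ.+ nat n ℚ.* δ , c , h ∘ subst (_∈ Below x) (+-step a δ n)
      decide (no h′) = search a a∈ n h′
    start : ∃ (Below x) → (∃ λ b → b ∉ Below x) → Near
    start (a , a∈) (b , b∉) = descend (archimedean δ 0<δ (b ℚ.- a))
      where
      descend : (∃ λ N → b ℚ.- a ℚ.≤ nat N ℚ.* δ) → Near
      descend (N , b-a≤Nδ) = search a a∈ N (b∉ ∘ closed-≤ x
        (subst (ℚ._≤ a ℚ.+ nat N ℚ.* δ) (+-cancel a b) (ℚ.+-monoʳ-≤ a b-a≤Nδ)))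

  lim-isLimit : ∀ ω x bd → IsLimit ω x (lim ω x bd)
  lim-isLimit ω x bd ε (e , e∉0 , e∈ε) = positive-part (rounded ε e∈ε)
    where
    L = lim ω x bd
    Close = (λ n → x n < L + ε × L < x n + ε) ∈ Mem ω
    combine : ∀ {c m δ} → c ∈ Below ε → δ ℚ.< m → m ℚ.< c →
              (∃ λ a → a ∈ Below L × a ℚ.+ δ ∉ Below L) → Close
    combine {c} {m} {δ} c∈ε δ<m m<c (a , a∈ , a+δ∉) =
      upward ω (λ {n} (a∈xₙ , a+m∉xₙ) →
          (a ℚ.+ m , a+m∉xₙ , (a ℚ.+ c , (a , c , a∈ , c∈ε , refl) , ℚ.+-monoʳ-< a m<c)) ,
          (a ℚ.+ δ , a+δ∉ , (a ℚ.+ c , (a , c , a∈xₙ , c∈ε , refl) , ℚ.+-monoʳ-< a (ℚ.<-trans δ<m m<c))))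
        (meet ω (lim-below ω x bd a∈) (lim-above ω x bd a+δ∉ (ℚ.+-monoʳ-< a δ<m)))
    choose-δ : ∀ {c m} → c ∈ Below ε → m ℚ.< c → (∃ λ δ → 0ℚ ℚ.< δ × δ ℚ.< m) → Close
    choose-δ c∈ε m<c (δ , 0<δ , δ<m) = combine c∈ε δ<m m<c (near L 0<δ)
    choose-m : ∀ {c} → c ∈ Below ε → (∃ λ m → 0ℚ ℚ.< m × m ℚ.< c) → Close
    choose-m c∈ε (m , 0<m , m<c) = choose-δ c∈ε m<c (ℚ.<-dense 0<m)
    positive-part : (∃ λ c → e ℚ.< c × c ∈ Below ε) → Close
    positive-part (c , e<c , c∈ε) = choose-m c∈ε
      (ℚ.<-dense (ℚ.≤-<-trans (ℚ.≮⇒≥ λ e<0 → e∉0 (0ℚ , refl , e<0)) e<c))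

  lim-+ : ∀ ω x bx y by z bz → (∀ n → z n ≈ x n + y n) →
          lim ω z bz ≈ lim ω x bx + lim ω y by
  lim-+ ω x bx y by z bz z≈x+y = to , from
    where
    X = lim ω x bx
    Y = lim ω y by
    Z = lim ω z bz
    from : X + Y ≤ Z
    from (_ , (a , b , (a′ , a′∈ , a<a′) , (b′ , b′∈ , b<b′) , refl) , q<a+b) =
      a ℚ.+ b , upward ω (λ {n} (a′∈xₙ , b′∈yₙ) → proj₂ (z≈x+y n)
        (a′ ℚ.+ b′ , (a′ , b′ , a′∈xₙ , b′∈yₙ , refl) , ℚ.+-mono-< a<a′ b<b′)) (meet ω a′∈ b′∈) , q<a+b
    clash : ∀ n {s A B} → s ∈ Below (z n) → A ∉ Below (x n) → B ∉ Below (y n) → s ℚ.< A ℚ.+ B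
    clash n {s} {A} {B} s∈zₙ A∉ B∉ = go (proj₁ (z≈x+y n) s∈zₙ)
      where
      go : s ∈ Below (x n + y n) → s ℚ.< A ℚ.+ B
      go (_ , (a , b , a∈ , b∈ , refl) , s<a+b) =
        ℚ.<-trans s<a+b (ℚ.+-mono-< (below<above (x n) a∈ A∉) (below<above (y n) b∈ B∉))
    Near : ℝ → ℚ → Set
    Near w δ = ∃ λ a → a ∈ Below w × a ℚ.+ δ ∉ Below w
    combine : ∀ {q s δ} → (λ n → s ∈ Below (z n)) ∈ Mem ω → 0ℚ ℚ.< δ → δ ℚ.+ δ ℚ.+ (δ ℚ.+ δ) ≡ s ℚ.- q →
              Near X δ → Near Y δ → q ∈ Below (X + Y)
    combine {q} {s} {δ} s∈ 0<δ 4δ≡s-q (a , a∈ , a+δ∉) (b , b∈ , b+δ∉) =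
      a ℚ.+ b , (a , b , a∈ , b∈ , refl) , ℚ.≰⇒> λ a+b≤q →
      proper ω (upward ω (λ {n} ((s∈zₙ , A∉xₙ) , B∉yₙ) →
          <⇒≱ (clash n s∈zₙ A∉xₙ B∉yₙ) (+-4δ a b q s δ 4δ≡s-q a+b≤q))
        (meet ω (meet ω s∈ (lim-above ω x bx a+δ∉ (<-+ (a ℚ.+ δ) 0<δ))) (lim-above ω y by b+δ∉ (<-+ (b ℚ.+ δ) 0<δ))))
    to : Z ≤ X + Y
    to {q} (s , s∈ , q<s) = choose (quarter q s q<s)
      where
      choose : (∃ λ δ → 0ℚ ℚ.< δ × δ ℚ.+ δ ℚ.+ (δ ℚ.+ δ) ≡ s ℚ.- q) → q ∈ Below (X + Y)
      choose (δ , 0<δ , 4δ≡s-q) = combine s∈ 0<δ 4δ≡s-q (near X 0<δ) (near Y 0<δ)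

  ∃floor : ∀ x → 0ℝ ≤ x → ∃ (IsFloor x)
  ∃floor x 0≤x = start (bounded x)
    where
    search : ∀ n → (∀ m → fromℕ m ≤ x → m ℕ.≤ n) → ∃ (IsFloor x)
    search zero    h = zero , subst (λ c → fromℚ c ≤ x) (sym nat-0) 0≤x , h
    search (suc n) h = decide em
      where
      decide : Dec (fromℕ (suc n) ≤ x) → ∃ (IsFloor x)
      decide (yes 1+n≤x) = suc n , 1+n≤x , h
      decide (no  1+n≰x) = search n λ m m≤x →
        ℕ.<⇒≤pred (ℕ.≤∧≢⇒< (h m m≤x) λ { refl → 1+n≰x m≤x })
    start : (∃ λ b → b ∉ Below x) → ∃ (IsFloor x)
    start (b , b∉) = descend (archimedean 1ℚ 0<1 b)
      where
      descend : (∃ λ N → b ℚ.≤ nat N ℚ.* 1ℚ) → ∃ (IsFloor x)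
      descend (N , b≤N) = search N λ m m≤x → nat-cancel-≤ m N
        (ℚ.≤-trans (≤-above {x = x} m≤x b∉) (subst (b ℚ.≤_) (ℚ.*-identityʳ (nat N)) b≤N))

  ⌊_⌋ : ∃ (0ℝ <_) → ℕ
  ⌊ x , 0<x ⌋ = proj₁ (∃floor x (<⇒≤ {0ℝ} {x} 0<x))

  ⌊⌋-isFloor : ∀ x → IsFloor (proj₁ x) ⌊ x ⌋
  ⌊⌋-isFloor (x , 0<x) = proj₂ (∃floor x (<⇒≤ {0ℝ} {x} 0<x))

  ⌊⌋-cong : ∀ x y → proj₁ x ≈ proj₁ y → ⌊ x ⌋ ≡ ⌊ y ⌋
  ⌊⌋-cong x y (x≤y , y≤x) = ℕ.≤-antisym
    (proj₂ (⌊⌋-isFloor y) ⌊ x ⌋ (x≤y ∘ proj₁ (⌊⌋-isFloor x)))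
    (proj₂ (⌊⌋-isFloor x) ⌊ y ⌋ (y≤x ∘ proj₁ (⌊⌋-isFloor y)))

  ∣_∩[1,_]∣ : Pred ℕ⁺ 0ℓ → ℕ → ℕ
  ∣ A ∩[1, N ]∣ = length (filter (λ k → em {k ∈ A}) (map 1+_ (upTo N)))

  count-cong : ∀ {A B} N → A ≐ B → ∣ A ∩[1, N ]∣ ≡ ∣ B ∩[1, N ]∣
  count-cong N A≐B = cong length (filter-≐ _ _ A≐B (map 1+_ (upTo N)))

  length-range : ∀ N → length (map 1+_ (upTo N)) ≡ N
  length-range N = trans (length-map 1+_ (upTo N)) (length-upTo N)

  count-≤ : ∀ A N → ∣ A ∩[1, N ]∣ ℕ.≤ N
  count-≤ A N = subst (∣ A ∩[1, N ]∣ ℕ.≤_) (length-range N) (length-filter _ (map 1+_ (upTo N)))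

  count-U : ∀ N → ∣ U ∩[1, N ]∣ ≡ N
  count-U N = trans (cong length (filter-all _ (All.universal (λ _ → tt) (map 1+_ (upTo N))))) (length-range N)

  count-∪ : ∀ {A B} N → Empty (A ∩ B) → ∣ A ∪ B ∩[1, N ]∣ ≡ ∣ A ∩[1, N ]∣ ℕ.+ ∣ B ∩[1, N ]∣
  count-∪ {A} {B} N disjoint = go (map 1+_ (upTo N))
    where
    go : ∀ ns → length (filter (λ k → em {k ∈ A ∪ B}) ns) ≡
                length (filter (λ k → em {k ∈ A}) ns) ℕ.+ length (filter (λ k → em {k ∈ B}) ns)
    go []       = refl
    go (n ∷ ns) with em {n ∈ A ∪ B} | em {n ∈ A} | em {n ∈ B}
    ... | _              | yes n∈A | yes n∈B = ⊥-elim (disjoint n (n∈A , n∈B))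
    ... | yes _          | yes _   | no _    = cong suc (go ns)
    ... | yes _          | no _    | yes _   = trans (cong suc (go ns)) (sym (ℕ.+-suc _ _))
    ... | yes (inj₁ n∈A) | no n∉A  | no _    = contradiction n∈A n∉A
    ... | yes (inj₂ n∈B) | no _    | no n∉B  = contradiction n∈B n∉B
    ... | no n∉          | yes n∈A | no _    = contradiction (inj₁ n∈A) n∉
    ... | no n∉          | no _    | yes n∈B = contradiction (inj₂ n∈B) n∉
    ... | no _           | no _    | no _    = go ns

  proportion : Pred ℕ⁺ 0ℓ → ∃ (0ℝ <_) → ℝ
  proportion A x = ∣ A ∩[1, ⌊ x ⌋ ]∣ ÷ x

  proportion-cong : ∀ A x y → proj₁ x ≈ proj₁ y → proportion A x ≈ proportion A y
  proportion-cong A x y x≈y = subst (λ N → proportion A x ≈ ∣ A ∩[1, N ]∣ ÷ y) (⌊⌋-cong x y x≈y)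
    (÷-cong ∣ A ∩[1, ⌊ x ⌋ ]∣ {x} {y} x≈y)

  1∉proportion : ∀ A x → 1ℚ ∉ Below (proportion A x)
  1∉proportion A x = ÷-≤1 ∣ A ∩[1, ⌊ x ⌋ ]∣ x λ h → proj₁ (⌊⌋-isFloor x)
    (fromℚ-mono-≤ (nat-mono-≤ ∣ A ∩[1, ⌊ x ⌋ ]∣ ⌊ x ⌋ (count-≤ A ⌊ x ⌋)) h)

  proportionSeq : [0,1] → Pred ℕ⁺ 0ℓ → ℕ⁺ → ℝ
  proportionSeq t A n = proportion A (θ·2^ t (val n))

  proportionSeq-bounded : ∀ t A → BoundedSeq (proportionSeq t A)
  proportionSeq-bounded t A = ℚ.- 1ℚ , 1ℚ , λ n →
    ÷-nonneg ∣ A ∩[1, ⌊ θ·2^ t (val n) ⌋ ]∣ (θ·2^ t (val n)) (0ℚ , refl , ℚ.negative⁻¹ (ℚ.- 1ℚ)) ,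
    1∉proportion A (θ·2^ t (val n))

  density : ℕ* × [0,1] → Pred ℕ⁺ 0ℓ → ℝ
  density (ω , t) A = lim (ultrafilter ω) (proportionSeq t A) (proportionSeq-bounded t A)

  density-cong : ∀ η {A B} → A ≐ B → density η A ≈ density η B
  density-cong (ω , t) {A} {B} A≐B = lim-cong (ultrafilter ω)
    (proportionSeq t A) (proportionSeq-bounded t A) (proportionSeq t B) (proportionSeq-bounded t B) λ n →
    subst (λ k → proportionSeq t A n ≈ k ÷ θ·2^ t (val n)) (count-cong ⌊ θ·2^ t (val n) ⌋ A≐B) (id , id)

  density-nonneg : ∀ η A → 0ℝ ≤ density η A
  density-nonneg (ω , t) A (_ , refl , q<0) = between (ℚ.<-dense q<0)
    where
    between : ∀ {q} → (∃ λ s → q ℚ.< s × s ℚ.< 0ℚ) → q ∈ Below (density (ω , t) A)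
    between (s , q<s , s<0) = s , full (ultrafilter ω) (λ n →
      ÷-nonneg ∣ A ∩[1, ⌊ θ·2^ t (val n) ⌋ ]∣ (θ·2^ t (val n)) (0ℚ , refl , s<0)) , q<s

  density-additive : ∀ η {A B} → Empty (A ∩ B) → density η (A ∪ B) ≈ density η A + density η B
  density-additive (ω , t) {A} {B} disjoint = lim-+ (ultrafilter ω)
    (proportionSeq t A) (proportionSeq-bounded t A) (proportionSeq t B) (proportionSeq-bounded t B)
    (proportionSeq t (A ∪ B)) (proportionSeq-bounded t (A ∪ B)) λ n → let x = θ·2^ t (val n) in
    subst (λ k → k ÷ x ≈ proportion A x + proportion B x) (sym (count-∪ ⌊ x ⌋ disjoint))
      (÷-distrib-+ ∣ A ∩[1, ⌊ x ⌋ ]∣ ∣ B ∩[1, ⌊ x ⌋ ]∣ x)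

  n≤2^n : ∀ n → n ℕ.≤ 2 ℕ.^ n
  n≤2^n zero    = z≤n
  n≤2^n (suc n) = ℕ.+-mono-≤ (ℕ.m^n>0 2 n) (ℕ.≤-trans (n≤2^n n) (ℕ.≤-reflexive (sym (ℕ.+-identityʳ (2 ℕ.^ n)))))

  n≤⌊θ·2^n⌋ : ∀ t n → n ℕ.≤ ⌊ θ·2^ t n ⌋
  n≤⌊θ·2^n⌋ t n = ℕ.≤-trans (n≤2^n n) (proj₂ (⌊⌋-isFloor (θ·2^ t n)) (2 ℕ.^ n) (2^n≤2^n·2^ n t))

  1+⌊⌋-above : ∀ x → nat (suc ⌊ x ⌋) ∉ Below (proj₁ x)
  1+⌊⌋-above (x , 0<x) h = ℕ.<-irrefl refl (proj₂ (⌊⌋-isFloor (x , 0<x)) (suc ⌊ x , 0<x ⌋)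
    (λ { (_ , refl , q<) → closed x q< h }))

  density-total : ∀ η → density η U ≈ 1ℝ
  density-total (ω , t) = to , from
    where
    u = ultrafilter ω
    to : density (ω , t) U ≤ 1ℝ
    to (s , s∈ , q<s) = 1ℚ , refl , ℚ.<-≤-trans q<s (ℚ.≮⇒≥ λ 1<s → proper u (upward u
      (λ {n} s∈xₙ → 1∉proportion U (θ·2^ t (val n)) (closed (proportionSeq t U n) 1<s s∈xₙ)) s∈))
    from : 1ℝ ≤ density (ω , t) U
    from {q} (_ , refl , q<1) = between (ℚ.<-dense q<1)
      where
      conclude : ∀ {p} → q ℚ.< p →
        (∃₂ λ s d → p ℚ.< s × ∀ k → d ℕ.≤ k → s ℚ.* nat (suc k) ℚ.≤ nat k) → q ∈ Below (density (ω , t) U)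
      conclude {p} q<p (s , d , p<s , large) = p , upward u (λ {n} d≤n → let x = θ·2^ t (val n) in
        s , (nat (suc ⌊ x ⌋) , 1+⌊⌋-above x ,
          subst (λ k → s ℚ.* nat (suc ⌊ x ⌋) ℚ.≤ nat k) (sym (count-U ⌊ x ⌋))
            (large ⌊ x ⌋ (ℕ.≤-trans d≤n (n≤⌊θ·2^n⌋ t (val n))))) , p<s)
        (eventually ω d) , q<p
      between : (∃ λ p → q ℚ.< p × p ℚ.< 1ℚ) → q ∈ Below (density (ω , t) U)
      between (p , q<p , p<1) = conclude q<p (near-one p p<1)

  ν : Setoid.Carrier Ω* → FinAddProb
  ν η = record
    { measure  = density η
    ; cong-≐   = density-cong η
    ; nonneg   = density-nonneg η
    ; total    = density-total η
    ; additive = density-additive η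
    }

  ν-isLimit : ∀ ω t A → IsLimit (ultrafilter ω) (proportionSeq t A) (measure (ν (ω , t)) A)
  ν-isLimit ω t A = lim-isLimit (ultrafilter ω) (proportionSeq t A) (proportionSeq-bounded t A)

  ν-glue : ∀ {η η′} → Glue η η′ → ν η ≈ₘ ν η′
  ν-glue (same {ω} {ω′} {t} {t′} (ω⊆ω′ , ω′⊆ω) t≈t′) A = lim-push id (ultrafilter ω) (ultrafilter ω′)
    (proportionSeq t A) (proportionSeq-bounded t A) (proportionSeq t′ A) (proportionSeq-bounded t′ A)
    (ω′⊆ω , ω⊆ω′)
    (λ n → proportion-cong A (θ·2^ t (val n)) (θ·2^ t′ (val n)) (θ·2^-cong {t} {t′} (val n) t≈t′))
  ν-glue (glue {ω} {ω′} {t} {t′} ω′≈τω t≈1 t′≈0) A = lim-push suc⁺ (ultrafilter ω) (ultrafilter ω′)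
    (proportionSeq t A) (proportionSeq-bounded t A) (proportionSeq t′ A) (proportionSeq-bounded t′ A)
    ω′≈τω
    (λ n → proportion-cong A (θ·2^ t (val n)) (θ·2^ t′ (val (suc⁺ n))) (θ·2^-glue {t} {t′} (val n) t≈1 t′≈0))

  -- ν is well defined on the quotient Ω*.
  ν-cong : ∀ {η η′} → Setoid._≈_ Ω* η η′ → ν η ≈ₘ ν η′
  ν-cong {η} Star.ε A = ≈-refl {density η A}
  ν-cong {η} {η′} (Star._◅_ {j = ζ} (fwd g) path) A = ≈-trans {density η A} {density ζ A} {density η′ A}
    (ν-glue {η} {ζ} g A) (ν-cong {ζ} {η′} path A)
  ν-cong {η} {η′} (Star._◅_ {j = ζ} (bwd g) path) A = ≈-trans {density η A} {density ζ A} {density η′ A}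
    (swap (ν-glue {ζ} {η} g A)) (ν-cong {ζ} {η′} path A)

{-# OPTIONS --safe #-}
module Submission where

-- If ω′ = τ^k ω, where by symmetry k ≥ 0, then along ω the fractions of [1, 2^n] taken up by D and by
-- its complement add up to 1, while ν_η(D) and ν_η′(∁ D) bound them up to
-- factors 2 and 2^(k + 1), so both measures cannot be small.
--
-- If ω′ is not on the orbit of ω, there are B ∈ ω and B′ ∈ ω′ such that
-- |n − n′| > m for all n ∈ B and n′ ∈ B′.  Let D be the union of the blocks
-- (2^(n − m), 2^(n + 1)] over n ∈ B′.  Below 2^(n + 1), all points of D for
-- n ∈ B, and all points of ∁ D for n ∈ B′, are at most 2^(n − m), so both
-- ν_η(D) and ν_η′(∁ D) are at most 2^(−m).

open import Defs
open import Axiom.ExcludedMiddle using (ExcludedMiddle)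
open import Data.Empty using (⊥)
open import Data.Integer.Base as ℤ using (ℤ; +_; -[1+_])
open import Data.List.Base using ([]; _∷_; length; map; filter; upTo)
open import Data.List.Properties
  using (upTo-∷ʳ; map-++; filter-++; length-++; filter-reject)
open import Data.Nat.Base as ℕ using (ℕ; zero; suc; z≤n; s≤s)
import Data.Nat.Properties as ℕ
open import Data.Nat.GeneralisedArithmetic using (fold; fold-+)
open import Data.Product.Base using (∃; ∃₂; _×_; _,_; proj₁; proj₂; swap)
open import Data.Rational.Base as ℚ using (ℚ; 0ℚ; 1ℚ)
import Data.Rational.Properties as ℚ
open import Data.Sum.Base using (_⊎_; inj₁; inj₂)
open import Function.Base using (_∘_; id)
open import Function.Bundles using (_⇔_; mk⇔; module Equivalence)
open import Level using (0ℓ)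
open import Relation.Binary.PropositionalEquality
  using (_≡_; refl; sym; trans; cong; subst; subst₂)
open import Relation.Nullary using (¬_; Dec; yes; no; contradiction)
open import Relation.Nullary.Decidable using (decidable-stable)
open import Relation.Unary
  using (Pred; Empty; _∈_; _∩_; _∉_; _⊆_; ∁; U; _⊢_)

-- The orbits of `τ*` as equivalence classes.

≈*-refl : ∀ {ω} → ω ≈* ω
≈*-refl = id , id

≈*-trans : ∀ {ω ω′ ω″} → ω ≈* ω′ → ω′ ≈* ω″ → ω ≈* ω″
≈*-trans (a , b) (c , d) = c ∘ a , b ∘ d

τ*-cong : ∀ {ω ω′} → ω ≈* ω′ → τ* ω ≈* τ* ω′
τ*-cong (a , b) = a , b

τ*⁻¹-cong : ∀ {ω ω′} → ω ≈* ω′ → τ*⁻¹ ω ≈* τ*⁻¹ ω′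
τ*⁻¹-cong (a , b) = a , b

fold-cong : ∀ {f} → (∀ {ω ω′} → ω ≈* ω′ → f ω ≈* f ω′) →
            ∀ {ω ω′} n → ω ≈* ω′ → fold ω f n ≈* fold ω′ f n
fold-cong f-cong zero ω≈ω′ = ω≈ω′
fold-cong {f} f-cong {ω} {ω′} (suc n) ω≈ω′ = f-cong {fold ω f n} {fold ω′ f n}
  (fold-cong {f} (λ {ω} {ω′} → f-cong {ω} {ω′}) {ω} {ω′} n ω≈ω′)

fold-shift : ∀ f (ω : ℕ*) n → f (fold ω f n) ≡ fold (f ω) f n
fold-shift f ω n = trans (cong (fold ω f) (ℕ.+-comm 1 n)) (fold-+ ω f n)

-- The innermost `f` meets the outermost `g`; `fold-shift` exposes that pair.
fold-cancel : ∀ f g → (∀ {ω ω′} → ω ≈* ω′ → f ω ≈* f ω′) → (∀ ω → f (g ω) ≈* ω) →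
              ∀ ω n → fold (fold ω g n) f n ≈* ω
fold-cancel f g f-cong inverse ω zero    = ≈*-refl {ω}
fold-cancel f g f-cong inverse ω (suc n) = subst (_≈* ω) (sym (fold-shift f (g ζ) n))
  (≈*-trans {fold (f (g ζ)) f n} {fold ζ f n} {ω}
    (fold-cong {f} (λ {ω} {ω′} → f-cong {ω} {ω′}) {f (g ζ)} {ζ} n (inverse ζ))
    (fold-cancel f g (λ {ω} {ω′} → f-cong {ω} {ω′}) inverse ω n))
  where ζ = fold ω g n

τ^-cong : ∀ {ω ω′} k → ω ≈* ω′ → τ^ k ω ≈* τ^ k ω′
τ^-cong {ω} {ω′} (+ n)    =
  fold-cong {τ*} (λ {ω} {ω′} → τ*-cong {ω} {ω′}) {ω} {ω′} n
τ^-cong {ω} {ω′} -[1+ n ] =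
  fold-cong {τ*⁻¹} (λ {ω} {ω′} → τ*⁻¹-cong {ω} {ω′}) {ω} {ω′} (suc n)

τ^-cancel : ∀ ω k → τ^ (ℤ.- k) (τ^ k ω) ≈* ω
τ^-cancel ω (+ zero)  = ≈*-refl {ω}
τ^-cancel ω (+ suc n) =
  fold-cancel τ*⁻¹ τ* (λ {ω} {ω′} → τ*⁻¹-cong {ω} {ω′}) τ*⁻¹-inverseˡ ω (suc n)
τ^-cancel ω -[1+ n ]  =
  fold-cancel τ* τ*⁻¹ (λ {ω} {ω′} → τ*-cong {ω} {ω′}) τ*⁻¹-inverseʳ ω (suc n)

τ^-flip : ∀ {ω ω′} k → ω′ ≈* τ^ k ω → ω ≈* τ^ (ℤ.- k) ω′
τ^-flip {ω} {ω′} k ω′≈ = swap (≈*-trans {τ^ (ℤ.- k) ω′} {τ^ (ℤ.- k) (τ^ k ω)} {ω}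
  (τ^-cong {ω′} {τ^ k ω} (ℤ.- k) ω′≈) (τ^-cancel ω k))

o-sym : ∀ {ω ω′} → ω′ ∈ o ω → ω ∈ o ω′
o-sym {ω} {ω′} (k , ω′≈) = ℤ.- k , τ^-flip {ω} {ω′} k ω′≈

o-resp : ∀ {ω ω′ ω″} → ω′ ≈* ω″ → ω″ ∈ o ω → ω′ ∈ o ω
o-resp {ω} {ω′} {ω″} ω′≈ω″ (k , ω″≈) = k , ≈*-trans {ω′} {ω″} {τ^ k ω} ω′≈ω″ ω″≈

o-τ* : ∀ {ω ω′} → ω′ ∈ o ω → τ* ω′ ∈ o ω
o-τ* {ω} {ω′} (k , ω′≈) = o-resp {ω} {τ* ω′} {τ* (τ^ k ω)}
  (τ*-cong {ω′} {τ^ k ω} ω′≈) (next k)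
  where
  next : ∀ k → τ* (τ^ k ω) ∈ o ω
  next (+ n)        = + suc n , ≈*-refl {τ^ (+ suc n) ω}
  next -[1+ zero ]  = + 0 , τ*⁻¹-inverseʳ ω
  next -[1+ suc n ] = -[1+ n ] , τ*⁻¹-inverseʳ (τ^ -[1+ n ] ω)

o-τ*⁻¹ : ∀ {ω ω′} → ω′ ∈ o ω → τ*⁻¹ ω′ ∈ o ω
o-τ*⁻¹ {ω} {ω′} (k , ω′≈) = o-resp {ω} {τ*⁻¹ ω′} {τ*⁻¹ (τ^ k ω)}
  (τ*⁻¹-cong {ω′} {τ^ k ω} ω′≈) (previous k)
  where
  previous : ∀ k → τ*⁻¹ (τ^ k ω) ∈ o ω
  previous (+ zero)  = -[1+ 0 ] , ≈*-refl {τ^ -[1+ 0 ] ω}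
  previous (+ suc n) = + n , τ*⁻¹-inverseˡ (τ^ (+ n) ω)
  previous -[1+ n ]  = -[1+ suc n ] , ≈*-refl {τ^ -[1+ suc n ] ω}

-- An orbit is closed under `τ*` and `τ*⁻¹`, hence under every `τ^ k`; this takes the place of
-- adding integer exponents.
o-trans : ∀ {ω ω′ ω″} → ω′ ∈ o ω → ω″ ∈ o ω′ → ω″ ∈ o ω
o-trans {ω} {ω′} {ω″} ω′∈ (k , ω″≈) = o-resp {ω} {ω″} {τ^ k ω′} ω″≈ (along k)
  where
  folds : ∀ f → (∀ {ζ} → ζ ∈ o ω → f ζ ∈ o ω) → ∀ n → fold ω′ f n ∈ o ω
  folds f step zero    = ω′∈
  folds f step (suc n) = step {fold ω′ f n} (folds f step n)
  along : ∀ k → τ^ k ω′ ∈ o ω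
  along (+ n)    = folds τ* (λ {ζ} → o-τ* {ω} {ζ}) n
  along -[1+ n ] = folds τ*⁻¹ (λ {ζ} → o-τ*⁻¹ {ω} {ζ}) (suc n)

disjoint-orbits⇔ : ∀ ω ω′ → Empty (o ω ∩ o ω′) ⇔ ω′ ∉ o ω
disjoint-orbits⇔ ω ω′ = mk⇔
  (λ empty ω′∈ → empty ω′ (ω′∈ , + 0 , ≈*-refl {ω′}))
  (λ ω′∉ ζ (ζ∈ω , ζ∈ω′) → ω′∉ (o-trans {ω} {ζ} {ω′} ζ∈ω (o-sym {ω′} {ζ} ζ∈ω′)))

-- Shifted ultrafilters and estimates for a single proportion.

shift : ℕ → ℕ⁺ → ℕ⁺
shift k (1+ n) = 1+ (k ℕ.+ n)

val-shift : ∀ k n → val (shift k n) ≡ k ℕ.+ val n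
val-shift k (1+ n) = sym (ℕ.+-suc k n)

-- `τ^ (+ k) ω` is the image of `ω` under `shift k`. This brings conditions along it back to `ω`,
-- where they can be intersected with others.
shift-mem : ∀ ω k {A} → A ∈ Mem (ultrafilter (τ^ (+ k) ω)) → (shift k ⊢ A) ∈ Mem (ultrafilter ω)
shift-mem ω zero    = id
shift-mem ω (suc k) = shift-mem ω k

θ·2^-upper : ∀ t n → proj₁ (θ·2^ t n) ≤ fromℕ (2 ℕ.^ suc n)
θ·2^-upper t n p∈ = subst (λ c → _ ∈ Below (fromℚ c))
  (trans (sym (nat-* (2 ℕ.^ n) 2)) (cong nat (ℕ.*-comm (2 ℕ.^ n) 2)))
  (proj₁ (·-fromℚ (2 ℕ.^ n) {{ℕ.m^n≢0 2 n}} (nat 2))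
    (·-mono-≤ (2 ℕ.^ n) {2^ t} {fromℕ 2} (2^≤2 t) p∈))

∉fromℚ : ∀ q → q ∉ Below (fromℚ q)
∉fromℚ q (_ , refl , q<q) = ℚ.<-irrefl refl q<q

0<fromℚ : ∀ {q} → 0ℚ ℚ.< q → 0ℝ < fromℚ q
0<fromℚ 0<q = 0ℚ , ∉fromℚ 0ℚ , _ , refl , 0<q

-- Since θ ≤ 2, the proportion is at least c / 2^(n + 1) ≥ 1 / d = `e′`. Lower classes are open, so
-- membership is claimed only for the smaller `e`.
large-proportion : ∀ {e e′} d c t n → e ℚ.< e′ → e′ ℚ.* nat d ≡ 1ℚ → 0ℚ ℚ.< e′ →
                   2 ℕ.^ suc n ℕ.≤ d ℕ.* c → e ∈ Below (c ÷ θ·2^ t n)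
large-proportion {e} {e′} d c t n e<e′ e′d≡1 0<e′ h =
  e′ , (r , (λ r∈ → ∉fromℚ r (θ·2^-upper t n r∈)) , e′r≤c) , e<e′
  where
  r = nat (2 ℕ.^ suc n)
  e′r≤c : e′ ℚ.* r ℚ.≤ nat c
  e′r≤c = subst (e′ ℚ.* r ℚ.≤_)
    (trans (cong (e′ ℚ.*_) (nat-* d c))
      (trans (sym (ℚ.*-assoc e′ (nat d) (nat c)))
        (trans (cong (ℚ._* nat c) e′d≡1) (ℚ.*-identityˡ (nat c)))))
    (ℚ.*-monoˡ-≤-nonNeg e′ {{ℚ.nonNegative (ℚ.<⇒≤ 0<e′)}} (nat-mono-≤ (2 ℕ.^ suc n) (d ℕ.* c) h))

-- Since θ ≥ 1, the proportion is at most c / 2^n ≤ 1 / d ≤ q. A witness s > q with denominator r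
-- would give r ≤ d q r < d s r ≤ d c ≤ 2^n ≤ r.
small-proportion : ∀ {q} d c t n → 1ℚ ℚ.≤ nat d ℚ.* q → 0 ℕ.< d →
                   d ℕ.* c ℕ.≤ 2 ℕ.^ n → q ∉ Below (c ÷ θ·2^ t n)
small-proportion {q} d c t n 1≤dq 0<d h (s , (r , r∉ , sr≤c) , q<s) =
  <⇒≱ (ℚ.≤-<-trans (subst (ℚ._≤ nat d ℚ.* q ℚ.* r) (ℚ.*-identityˡ r)
        (ℚ.*-monoʳ-≤-nonNeg r {{ℚ.nonNegative (ℚ.<⇒≤ 0<r)}} 1≤dq))
      (ℚ.*-monoˡ-<-pos r {{ℚ.positive 0<r}}
        (ℚ.*-monoʳ-<-pos (nat d) {{ℚ.positive (nat-0< d 0<d)}} q<s)))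
    (ℚ.≤-trans (subst₂ ℚ._≤_ (sym (ℚ.*-assoc (nat d) s r)) (sym (nat-* d c))
        (ℚ.*-monoˡ-≤-nonNeg (nat d) {{ℚ.nonNegative (nat-0≤ d)}} sr≤c))
      (ℚ.≤-trans (nat-mono-≤ (d ℕ.* c) (2 ℕ.^ n) h)
        (≤-above {x = proj₁ (θ·2^ t n)} (2^n≤2^n·2^ n t) r∉)))
  where
  0<r : 0ℚ ℚ.< r
  0<r = above-pos {proj₁ (θ·2^ t n)} (proj₂ (θ·2^ t n)) r∉

unit-fraction : ∀ d → 0 ℕ.< d → ∃₂ λ e e′ → 0ℚ ℚ.< e × e ℚ.< e′ × e′ ℚ.* nat d ≡ 1ℚ
unit-fraction d 0<d =
  let e′ , e′d≡1     = quotient 1ℚ (nat d) (nat-0< d 0<d)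
      e , 0<e , e<e′ = ℚ.<-dense (0<e′ e′ e′d≡1)
  in e , e′ , 0<e , e<e′ , e′d≡1
  where
  0<e′ : ∀ e′ → e′ ℚ.* nat d ≡ 1ℚ → 0ℚ ℚ.< e′
  0<e′ e′ e′d≡1 = ℚ.*-cancelʳ-<-nonNeg (nat d) {{ℚ.nonNegative (nat-0≤ d)}}
    (subst₂ ℚ._<_ (sym (ℚ.*-zeroˡ (nat d))) (sym e′d≡1) 0<1)

half-of-sum : ∀ {N} a b → N ℕ.≤ a ℕ.+ b → N ℕ.≤ 2 ℕ.* a ⊎ N ℕ.≤ 2 ℕ.* b
half-of-sum {N} a b N≤a+b with ℕ.≤-total a b
... | inj₁ a≤b = inj₂ (ℕ.≤-trans N≤a+b
  (subst (λ c → a ℕ.+ b ℕ.≤ b ℕ.+ c) (sym (ℕ.+-identityʳ b)) (ℕ.+-monoˡ-≤ b a≤b)))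
... | inj₂ b≤a = inj₁ (ℕ.≤-trans N≤a+b
  (subst (λ c → a ℕ.+ b ℕ.≤ a ℕ.+ c) (sym (ℕ.+-identityʳ a)) (ℕ.+-monoʳ-≤ a b≤a)))

-- The factor 2^(k + 2) pays for θ ≤ 2, for filling only half of [1, 2^n], and for a shift by j ≤ k
-- levels.
half⇒large : ∀ {j k} n c → j ℕ.≤ k → 2 ℕ.^ n ℕ.≤ 2 ℕ.* c →
             2 ℕ.^ suc (j ℕ.+ n) ℕ.≤ 2 ℕ.^ suc (suc k) ℕ.* c
half⇒large {j} {k} n c j≤k h = begin
  2 ℕ.^ (suc j ℕ.+ n)             ≡⟨ ℕ.^-distribˡ-+-* 2 (suc j) n ⟩
  2 ℕ.^ suc j ℕ.* 2 ℕ.^ n         ≤⟨ ℕ.*-mono-≤ (ℕ.^-monoʳ-≤ 2 (s≤s j≤k)) h ⟩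
  2 ℕ.^ suc k ℕ.* (2 ℕ.* c)       ≡⟨ ℕ.*-assoc (2 ℕ.^ suc k) 2 c ⟨
  2 ℕ.^ suc k ℕ.* 2 ℕ.* c         ≡⟨ cong (ℕ._* c) (ℕ.*-comm (2 ℕ.^ suc k) 2) ⟩
  2 ℕ.^ suc (suc k) ℕ.* c         ∎
  where open ℕ.≤-Reasoning

module _ (em : ∀ {ℓ} → ExcludedMiddle ℓ) where

  open Classical (em {0ℓ})

  -- Counting in initial segments.

  count-suc : ∀ A N → ∣ A ∩[1, suc N ]∣ ≡
    ∣ A ∩[1, N ]∣ ℕ.+ length (filter (λ k → em {0ℓ} {k ∈ A}) (1+ N ∷ []))
  count-suc A N = trans
    (cong (λ ns → length (filter (λ k → em {0ℓ} {k ∈ A}) ns))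
      (trans (cong (map 1+_) (sym (upTo-∷ʳ N))) (map-++ 1+_ (upTo N) (N ∷ []))))
    (trans (cong length (filter-++ (λ k → em {0ℓ} {k ∈ A}) (map 1+_ (upTo N)) (1+ N ∷ [])))
      (length-++ (filter (λ k → em {0ℓ} {k ∈ A}) (map 1+_ (upTo N)))))

  count-mono-≤ : ∀ A {M N} → M ℕ.≤ N → ∣ A ∩[1, M ]∣ ℕ.≤ ∣ A ∩[1, N ]∣
  count-mono-≤ A = go ∘ ℕ.≤⇒≤′
    where
    go : ∀ {M N} → M ℕ.≤′ N → ∣ A ∩[1, M ]∣ ℕ.≤ ∣ A ∩[1, N ]∣
    go ℕ.≤′-refl                 = ℕ.≤-refl
    go {N = suc N} (ℕ.≤′-step h) = ℕ.≤-trans (go h)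
      (subst (∣ A ∩[1, N ]∣ ℕ.≤_) (sym (count-suc A N)) (ℕ.m≤m+n ∣ A ∩[1, N ]∣ _))

  count-∁ : ∀ A N → N ≡ ∣ A ∩[1, N ]∣ ℕ.+ ∣ ∁ A ∩[1, N ]∣
  count-∁ A N = trans (sym (count-U N)) (trans
    (count-cong N ((λ {k} _ → decide em) , λ _ → _))
    (count-∪ N λ k (k∈ , k∉) → k∉ k∈))
    where
    decide : ∀ {P : Set} → Dec P → P ⊎ ¬ P
    decide (yes p) = inj₁ p
    decide (no ¬p) = inj₂ ¬p

  -- The number of elements of `A` up to `N` is at most the largest of them; the induction descends
  -- to that element.
  count-bounded : ∀ A d {b} N → (∀ k → val k ℕ.≤ N → k ∈ A → d ℕ.* val k ℕ.≤ b) →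
                  d ℕ.* ∣ A ∩[1, N ]∣ ℕ.≤ b
  count-bounded A d {b} zero    h = subst (ℕ._≤ b) (sym (ℕ.*-zeroʳ d)) z≤n
  count-bounded A d {b} (suc N) h = decide em
    where
    decide : Dec (1+ N ∈ A) → d ℕ.* ∣ A ∩[1, suc N ]∣ ℕ.≤ b
    decide (yes 1+N∈) = ℕ.≤-trans (ℕ.*-monoʳ-≤ d (count-≤ A (suc N))) (h (1+ N) ℕ.≤-refl 1+N∈)
    decide (no 1+N∉)  = subst (λ c → d ℕ.* c ℕ.≤ b)
      (sym (trans (count-suc A N) (trans
        (cong (λ ns → ∣ A ∩[1, N ]∣ ℕ.+ length ns) (filter-reject (λ k → em {0ℓ} {k ∈ A}) 1+N∉))
        (ℕ.+-identityʳ _))))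
      (count-bounded A d N λ k k≤N → h k (ℕ.m≤n⇒m≤1+n k≤N))

  -- Bounds on the integer part of θ·2^n, and non-singularity on one orbit.

  2^n≤⌊θ·2^n⌋ : ∀ t n → 2 ℕ.^ n ℕ.≤ ⌊ θ·2^ t n ⌋
  2^n≤⌊θ·2^n⌋ t n = proj₂ (⌊⌋-isFloor (θ·2^ t n)) (2 ℕ.^ n) (2^n≤2^n·2^ n t)

  ⌊θ·2^n⌋≤2^1+n : ∀ t n → ⌊ θ·2^ t n ⌋ ℕ.≤ 2 ℕ.^ suc n
  ⌊θ·2^n⌋≤2^1+n t n = nat-cancel-≤ _ _ (fromℚ-cancel-≤ λ p∈ →
    θ·2^-upper t n (proj₁ (⌊⌋-isFloor (θ·2^ t n)) p∈))

  -- At each n, `A` or `B` fills half of [1, 2^n], which makes its proportion large at level n or k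
  -- + n respectively. `A` and `B` are tied only by the symmetric condition `cover`, so the roles
  -- can be exchanged for negative exponents.
  not-both-small : ∀ {e e′ k} ω ω′ t t′ {A B} → ω′ ≈* τ^ (+ k) ω →
    e ℚ.< e′ → e′ ℚ.* nat (2 ℕ.^ suc (suc k)) ≡ 1ℚ → 0ℚ ℚ.< e′ →
    (∀ N → N ≡ ∣ A ∩[1, N ]∣ ℕ.+ ∣ B ∩[1, N ]∣) →
    density (ω , t) A < fromℚ e → ¬ (density (ω′ , t′) B < fromℚ e)
  not-both-small {e} {e′} {k} ω ω′ t t′ {A} {B} (ω′⊆ , _) e<e′ e′d≡1 0<e′ cover
    (p , p∉ , _ , refl , p<e) (q , q∉ , _ , refl , q<e) =
    proper u (upward u (λ {n} (a , b) → clash n a b) (meet u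
      (lim-above u (proportionSeq t A) (proportionSeq-bounded t A) p∉ p<e)
      (shift-mem ω k (ω′⊆
        (lim-above (ultrafilter ω′) (proportionSeq t′ B) (proportionSeq-bounded t′ B) q∉ q<e)))))
    where
    u = ultrafilter ω
    clash : ∀ n → e ∉ Below (proportionSeq t A n) → e ∉ Below (proportionSeq t′ B (shift k n)) → ⊥
    clash n e∉A e∉B = conclude
      (half-of-sum ∣ A ∩[1, 2 ℕ.^ val n ]∣ ∣ B ∩[1, 2 ℕ.^ val n ]∣
        (ℕ.≤-reflexive (cover (2 ℕ.^ val n))))
      where
      large : ∀ t C j n′ → val n′ ≡ j ℕ.+ val n → j ℕ.≤ k →
              2 ℕ.^ val n ℕ.≤ 2 ℕ.* ∣ C ∩[1, 2 ℕ.^ val n ]∣ → e ∈ Below (proportionSeq t C n′)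
      large t C j n′ eq j≤k h = large-proportion (2 ℕ.^ suc (suc k)) c t (val n′) e<e′ e′d≡1 0<e′
        (subst (λ l → 2 ℕ.^ suc l ℕ.≤ 2 ℕ.^ suc (suc k) ℕ.* c) (sym eq)
          (half⇒large (val n) c j≤k (ℕ.≤-trans h (ℕ.*-monoʳ-≤ 2 (count-mono-≤ C 2^n≤N′)))))
        where
        c = ∣ C ∩[1, ⌊ θ·2^ t (val n′) ⌋ ]∣
        2^n≤N′ : 2 ℕ.^ val n ℕ.≤ ⌊ θ·2^ t (val n′) ⌋
        2^n≤N′ = ℕ.≤-trans (ℕ.^-monoʳ-≤ 2 (subst (val n ℕ.≤_) (sym eq) (ℕ.m≤n+m (val n) j)))
          (2^n≤⌊θ·2^n⌋ t (val n′))
      conclude : 2 ℕ.^ val n ℕ.≤ 2 ℕ.* ∣ A ∩[1, 2 ℕ.^ val n ]∣ ⊎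
                 2 ℕ.^ val n ℕ.≤ 2 ℕ.* ∣ B ∩[1, 2 ℕ.^ val n ]∣ → ⊥
      conclude (inj₁ h) = e∉A (large t A 0 n refl z≤n h)
      conclude (inj₂ h) = e∉B (large t′ B k (shift k n) (val-shift k n) ℕ.≤-refl h)

  singular⇒∉orbit : ∀ ω ω′ t t′ → Singular (ν (ω , t)) (ν (ω′ , t′)) → ω′ ∉ o ω
  singular⇒∉orbit ω ω′ t t′ singular (+ k , ω′≈) =
    -- The tolerance `e` is below 1 / 2^(k + 2), the proportion that one of the two sets must reach.
    let e , e′ , 0<e , e<e′ , e′d≡1 = unit-fraction (2 ℕ.^ suc (suc k)) (ℕ.m^n>0 2 (suc (suc k)))
        D , small , small′ = singular (fromℚ e) (0<fromℚ 0<e)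
    in not-both-small {e} {e′} {k} ω ω′ t t′ {D} {∁ D} ω′≈ e<e′ e′d≡1 (ℚ.<-trans 0<e e<e′)
         (count-∁ D) small small′
  -- Here ω = τ^(k + 1) ω′, so the two points, and with them `D` and `∁ D`, change places.
  singular⇒∉orbit ω ω′ t t′ singular (-[1+ k ] , ω′≈) =
    let e , e′ , 0<e , e<e′ , e′d≡1 = unit-fraction (2 ℕ.^ suc (suc (suc k)))
          (ℕ.m^n>0 2 (suc (suc (suc k))))
        D , small , small′ = singular (fromℚ e) (0<fromℚ 0<e)
    in not-both-small {e} {e′} {suc k} ω′ ω t′ t {∁ D} {D} (τ^-flip {ω} {ω′} -[1+ k ] ω′≈)
         e<e′ e′d≡1 (ℚ.<-trans 0<e e<e′)
         (λ N → trans (count-∁ D N) (ℕ.+-comm ∣ D ∩[1, N ]∣ ∣ ∁ D ∩[1, N ]∣)) small′ small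

  -- Separating different orbits, and singularity.

  distinguish : ∀ ω ω′ → ¬ (ω′ ≈ᵤ ω) → ∃ λ C → C ∈ Mem ω × ∁ C ∈ Mem ω′
  -- Without such a set, `Mem ω` would be contained in `Mem ω′`, and equal to it because
  -- ultrafilters are maximal.
  distinguish ω ω′ ω′≉ω = decidable-stable em λ none →
    let ω⊆ω′ : Mem ω ⊆ Mem ω′
        ω⊆ω′ {C} C∈ω = decidable-stable em λ C∉ω′ → none (C , C∈ω , mem-∁ ω′ C∉ω′)
    in ω′≉ω ((λ {C} C∈ω′ → decidable-stable em λ C∉ω →
      proper ω′ (upward ω′ (λ (x , ¬x) → ¬x x) (meet ω′ C∈ω′ (ω⊆ω′ (mem-∁ ω C∉ω))))) , ω⊆ω′)

  -- Each induction step excludes one difference: `C` belongs to `τ^ (+ m) ω` and `∁ C` to `ω′`, so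
  -- m + n ∈ C and n′ ∉ C rule out n′ = m + n. The order n′ ≤ n is handled by exchanging `ω` and
  -- `ω′`.
  separate : ∀ ω ω′ → (∀ j → ¬ (ω′ ≈* τ^ (+ j) ω)) → ∀ m → ∃₂ λ B B′ →
    B ∈ Mem (ultrafilter ω) × B′ ∈ Mem (ultrafilter ω′) ×
    (∀ n n′ → n ∈ B → n′ ∈ B′ → val n ℕ.≤ val n′ → m ℕ.+ val n ℕ.≤ val n′)
  separate ω ω′ apart zero = U , U , full (ultrafilter ω) _ , full (ultrafilter ω′) _ , λ _ _ _ _ h → h
  separate ω ω′ apart (suc m) with separate ω ω′ apart m
    | distinguish (ultrafilter (τ^ (+ m) ω)) (ultrafilter ω′) (apart m)
  ... | B , B′ , B∈ , B′∈ , far | C , C∈ , ∁C∈ =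
    B ∩ (shift m ⊢ C) , B′ ∩ ∁ C ,
    meet (ultrafilter ω) B∈ (shift-mem ω m C∈) , meet (ultrafilter ω′) B′∈ ∁C∈ ,
    λ { n (1+ n′) (n∈ , s∈) (n′∈ , n′∉) n≤n′ → ℕ.≤∧≢⇒< (far n (1+ n′) n∈ n′∈ n≤n′)
      λ eq → n′∉ (subst (_∈ C) (cong 1+_ (ℕ.suc-injective (trans (val-shift m n) eq))) s∈) }

  small-density : ∀ {q ε} ω t A d S → q ∈ Below ε → 1ℚ ℚ.≤ nat d ℚ.* q → 0 ℕ.< d →
    S ∈ Mem (ultrafilter ω) →
    (∀ n → n ∈ S → ∀ k → val k ℕ.≤ 2 ℕ.^ suc (val n) → k ∈ A → d ℕ.* val k ℕ.≤ 2 ℕ.^ val n) →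
    density (ω , t) A < ε
  small-density {q} ω t A d S q∈ε 1≤dq 0<d S∈ thin = q , q∉ , q∈ε
    where
    u = ultrafilter ω
    q∉ : q ∉ Below (density (ω , t) A)
    q∉ q∈ = proper u (upward u
      (λ {n} (n∈S , q∈xₙ) → small-proportion d ∣ A ∩[1, ⌊ θ·2^ t (val n) ⌋ ]∣ t (val n) 1≤dq 0<d
        (count-bounded A d ⌊ θ·2^ t (val n) ⌋
          λ k k≤ → thin n n∈S k (ℕ.≤-trans k≤ (⌊θ·2^n⌋≤2^1+n t (val n)))) q∈xₙ)
      (meet u S∈ (lim-below u (proportionSeq t A) (proportionSeq-bounded t A) q∈)))

  module _ (ω ω′ : ℕ*) (t t′ : [0,1]) {B B′ : Pred ℕ⁺ 0ℓ}
    (B∈ : B ∈ Mem (ultrafilter ω)) (B′∈ : B′ ∈ Mem (ultrafilter ω′)) (m : ℕ)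
    (far : ∀ n n′ → n ∈ B → n′ ∈ B′ →
           (val n ℕ.≤ val n′ → suc m ℕ.+ val n ℕ.≤ val n′) ×
           (val n′ ℕ.≤ val n → suc m ℕ.+ val n′ ℕ.≤ val n))
    where

    private
      d : ℕ
      d = 2 ℕ.^ m

    -- The union of the blocks (2^(n - m), 2^(n + 1)] over n in `B′`; multiplying the lower end by d
    -- = 2^m avoids a negative exponent when n < m.
    D : Pred ℕ⁺ 0ℓ
    D k = ∃ λ n → n ∈ B′ × 2 ℕ.^ val n ℕ.< d ℕ.* val k × val k ℕ.≤ 2 ℕ.^ suc (val n)

    d·2^-mono : ∀ {k n n′} → k ℕ.≤ 2 ℕ.^ suc n → suc m ℕ.+ n ℕ.≤ n′ → d ℕ.* k ℕ.≤ 2 ℕ.^ n′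
    d·2^-mono {k} {n} {n′} k≤ 1+m+n≤n′ = begin
      d ℕ.* k               ≤⟨ ℕ.*-monoʳ-≤ d k≤ ⟩
      d ℕ.* 2 ℕ.^ suc n     ≡⟨ ℕ.^-distribˡ-+-* 2 m (suc n) ⟨
      2 ℕ.^ (m ℕ.+ suc n)   ≡⟨ cong (2 ℕ.^_) (ℕ.+-suc m n) ⟩
      2 ℕ.^ (suc m ℕ.+ n)   ≤⟨ ℕ.^-monoʳ-≤ 2 1+m+n≤n′ ⟩
      2 ℕ.^ n′              ∎
      where open ℕ.≤-Reasoning

    -- The gap m + 1 puts the blocks of larger n′ wholly beyond 2^(n + 1), and makes those of
    -- smaller n′ end by 2^(n - m).
    D-thin : ∀ n → n ∈ B → ∀ k → val k ℕ.≤ 2 ℕ.^ suc (val n) → k ∈ D → d ℕ.* val k ℕ.≤ 2 ℕ.^ val n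
    D-thin n n∈ k k≤ (n′ , n′∈ , below , k≤′) = by-order (ℕ.≤-total (val n) (val n′))
      where
      by-order : val n ℕ.≤ val n′ ⊎ val n′ ℕ.≤ val n → d ℕ.* val k ℕ.≤ 2 ℕ.^ val n
      by-order (inj₁ n≤n′) = contradiction (d·2^-mono k≤ (proj₁ (far n n′ n∈ n′∈) n≤n′)) (ℕ.<⇒≱ below)
      by-order (inj₂ n′≤n) = d·2^-mono k≤′ (proj₂ (far n n′ n∈ n′∈) n′≤n)

    ∁D-thin : ∀ n → n ∈ B′ → ∀ k → val k ℕ.≤ 2 ℕ.^ suc (val n) → k ∈ ∁ D → d ℕ.* val k ℕ.≤ 2 ℕ.^ val n
    ∁D-thin n n∈ k k≤ k∉ = ℕ.≮⇒≥ λ below → k∉ (n , n∈ , below , k≤)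

    far⇒small : ∀ {q ε} → q ∈ Below ε → 0ℚ ℚ.≤ q → 1ℚ ℚ.≤ nat m ℚ.* q →
      ∃ λ D → density (ω , t) D < ε × density (ω′ , t′) (∁ D) < ε
    far⇒small {q} {ε} q∈ε 0≤q 1≤mq = D ,
      small-density {q} {ε} ω t D d B q∈ε 1≤dq (ℕ.m^n>0 2 m) B∈ D-thin ,
      small-density {q} {ε} ω′ t′ (∁ D) d B′ q∈ε 1≤dq (ℕ.m^n>0 2 m) B′∈ ∁D-thin
      where
      1≤dq : 1ℚ ℚ.≤ nat d ℚ.* q
      -- As m ≤ 2^m = d, the archimedean choice of m with m q ≥ 1 is enough.
      1≤dq = ℚ.≤-trans 1≤mq (ℚ.*-monoʳ-≤-nonNeg q {{ℚ.nonNegative 0≤q}} (nat-mono-≤ m d (n≤2^n m)))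

  ∉orbit⇒singular : ∀ ω ω′ t t′ → ω′ ∉ o ω → Singular (ν (ω , t)) (ν (ω′ , t′))
  ∉orbit⇒singular ω ω′ t t′ ω′∉ ε (e , e∉0 , e∈ε) =
    let q , e<q , q∈ε = rounded ε e∈ε
        0<q           = ℚ.≤-<-trans (ℚ.≮⇒≥ λ e<0 → e∉0 (0ℚ , refl , e<0)) e<q
        m , 1≤mq      = archimedean q 0<q 1ℚ
        -- One application for each order of n and n′; the intersections then satisfy both
        -- conditions.
        B₁ , B₁′ , B₁∈ , B₁′∈ , far₁ = separate ω ω′ (λ j ω′≈ → ω′∉ (+ j , ω′≈)) (suc m)
        B₂′ , B₂ , B₂′∈ , B₂∈ , far₂ = separate ω′ ω (λ j ω≈ → ω′∉ (o-sym {ω′} {ω} (+ j , ω≈))) (suc m)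
    in far⇒small ω ω′ t t′ {B₁ ∩ B₂} {B₁′ ∩ B₂′}
         (meet (ultrafilter ω) B₁∈ B₂∈) (meet (ultrafilter ω′) B₁′∈ B₂′∈) m
         (λ n n′ (n∈₁ , n∈₂) (n′∈₁ , n′∈₂) → far₁ n n′ n∈₁ n′∈₁ , far₂ n′ n n′∈₂ n∈₂)
         {q} {ε} q∈ε (ℚ.<⇒≤ 0<q) 1≤mq

theorem3p6 : (em : ∀ {ℓ} → ExcludedMiddle ℓ) (ω ω′ : ℕ*) (t t′ : [0,1]) →
    (Singular (Classical.ν em (ω , t)) (Classical.ν em (ω′ , t′)) ⇔ Empty (o ω ∩ o ω′)) ×
    (Empty (o ω ∩ o ω′) ⇔ ω′ ∉ o ω)
theorem3p6 em ω ω′ t t′ =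
  mk⇔ (Equivalence.from orbits ∘ singular⇒∉orbit em ω ω′ t t′)
      (∉orbit⇒singular em ω ω′ t t′ ∘ Equivalence.to orbits) ,
  orbits
  where orbits = disjoint-orbits⇔ ω ω′
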